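{- Let $H$ be a fixed simple graph on the vertex set $[p]=\{1,\ldots,p\}$. Then $$\sum_{\lambda_1,\ldots,\lambda_p\geq0}\chi_{H[\lambda]}(q)\prod_{i=1}^p\frac{x_i^{\lambda_i}}{\lambda_i!}=B_H(x_1,\ldots,x_p)^q .$$ The identity holds coefficientwise as an identity of formal power series in $x_1,\ldots,x_p$, with coefficients polynomial in $q$ (hence for all complex $q$). Near the origin the right-hand side is $\exp(q\,\mathrm{Log}\,B_H)$ with the principal branch of $\mathrm{Log}$; here $B_H(0,\ldots,0)=1$.
   Context: For $\lambda=(\lambda_1,\ldots,\lambda_p)$ with $\lambda_i\ge0$, $H[\lambda]$ is the graph obtained from $H$ by replacing vertex $i$ with an independent set of size $\lambda_i$ and each edge $ij\in E(H)$ with all edges between the $i$-th and $j$-th sets. $\chi_G$ is the chromatic polynomial (equal to $1$ for the graph with no vertices). $\mathrm{Ind}(H)$ is the collection of independent sets of $H$, including the empty set, and $$B_H(x_1,\ldots,x_p)=\sum_{I\in\mathrm{Ind}(H)}\prod_{i\in I}(e^{x_i}-1).$$ -}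

module Defs where

open import Algebra.Bundles using (CommutativeRing)
open import Algebra.Bundles.Raw using (RawRing)
import Algebra.Definitions.RawSemiring as RawSemiringOps
import Algebra.Properties.Semiring.Sum as SemiringSum
open import Data.Bool.Base using (true; false; if_then_else_)
open import Data.Fin.Base using (Fin; zero; suc; splitAt)
import Data.Fin.Properties as Fin
open import Data.Fin.Subset using (Subset; inside; outside; _∈_)
open import Data.Fin.Subset.Properties using (_∈?_)
import Data.Integer.Base as ℤ
open import Data.List.Base as List
  using (List; []; _∷_; allFin; applyUpTo; cartesianProductWith; filter; foldr; length; upTo)
import Data.List.Properties as List
open import Data.Nat.Base as ℕ using (ℕ; zero; suc; _∸_; _!)
import Data.Nat.Properties as ℕ
open import Data.Product.Base using (_×_; _,_; proj₁; proj₂)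
open import Data.Rational.Base as ℚ using (ℚ; 0ℚ; 1ℚ)
import Data.Rational.Properties as ℚ
open import Data.Rational.Solver using (module +-*-Solver)
open import Data.Sum.Base using (_⊎_; inj₁; inj₂; [_,_]′)
open import Data.Vec.Base as Vec using (Vec; []; _∷_; lookup; zipWith; replicate; _[_]≔_)
import Data.Vec.Functional as Vector
import Data.Vec.Properties as Vec
open import Function.Base using (_∘_; const; id)
open import Function.Definitions using (Injective)
open import Level using (0ℓ)
open import Relation.Binary.Core using (Rel)
open import Relation.Binary.Definitions using (Symmetric; Irreflexive; Decidable)
open import Relation.Binary.PropositionalEquality
  using (_≡_; _≢_; refl; sym; trans; cong; cong₂; subst; module ≡-Reasoning)
open import Relation.Nullary.Decidable
  using (Dec; yes; no; does; ¬?; _→-dec_; _×-dec_; _⊎-dec_)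
open import Relation.Nullary.Negation using (¬_; contradiction)
import Relation.Unary as Unary

record Graph (n : ℕ) : Set₁ where
  field
    Adj    : Rel (Fin n) 0ℓ
    symm   : Symmetric Adj
    irrefl : Irreflexive _≡_ Adj
    adj?   : Decidable Adj

open Graph

pullback : ∀ {m n} → (Fin m → Fin n) → Graph n → Graph m
pullback f G = record
  { Adj    = λ u v → Adj G (f u) (f v)
  ; symm   = symm G
  ; irrefl = λ u≡v → irrefl G (cong f u≡v)
  ; adj?   = λ u v → adj? G (f u) (f v)
  }

-- blowUp H λ is H[λ]: its vertices are 0, 1, …, λ₁ + … + λₚ - 1, cut into
-- consecutive intervals of lengths λ₁, …, λₚ; `block` names the interval of a vertex.

block : ∀ {p} (l : Vec ℕ p) → Fin (Vec.sum l) → Fin p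
block (m ∷ l) v = [ const zero , suc ∘ block l ]′ (splitAt m v)

blowUp : ∀ {p} → Graph p → (l : Vec ℕ p) → Graph (Vec.sum l)
blowUp H l = pullback (block l) H

vectors : ∀ {A : Set} → List A → (n : ℕ) → List (Vec A n)
vectors xs zero    = [] ∷ []
vectors xs (suc n) = cartesianProductWith _∷_ xs (vectors xs n)

Independent : ∀ {n} → Graph n → Subset n → Set
Independent G I = ∀ i j → i ∈ I → j ∈ I → ¬ Adj G i j

independent? : ∀ {n} (G : Graph n) → Unary.Decidable (Independent G)
independent? G I = Fin.all? λ i → Fin.all? λ j →
  (i ∈? I) →-dec ((j ∈? I) →-dec ¬? (adj? G i j))

Ind : ∀ {n} → Graph n → List (Subset n)
Ind {n} G = filter (independent? G) (vectors (outside ∷ inside ∷ []) n)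

Proper : ∀ {n k} → Graph n → Vec (Fin k) n → Set
Proper G f = ∀ i j → Adj G i j → lookup f i ≢ lookup f j

proper? : ∀ {n k} (G : Graph n) → Unary.Decidable (Proper {k = k} G)
proper? G f = Fin.all? λ i → Fin.all? λ j →
  adj? G i j →-dec ¬? (lookup f i Fin.≟ lookup f j)

#properColourings : ∀ {n} → Graph n → ℕ → ℕ
#properColourings {n} G k = length (filter (proper? G) (vectors (allFin k) n))

-- Polynomials are coefficient lists, constant term first; trailing zeros are
-- ignored by the equality of ℚ[q].

coeff : List ℚ → ℕ → ℚ
coeff []      _       = 0ℚ
coeff (a ∷ P) zero    = a
coeff (a ∷ P) (suc n) = coeff P n

infixl 6 _⊞_
infixl 7 _⊠_

_⊞_ : List ℚ → List ℚ → List ℚ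
[]      ⊞ Q       = Q
(a ∷ P) ⊞ []      = a ∷ P
(a ∷ P) ⊞ (b ∷ Q) = (a ℚ.+ b) ∷ (P ⊞ Q)

_⊠_ : List ℚ → List ℚ → List ℚ
[]      ⊠ Q = []
(a ∷ P) ⊠ Q = List.map (a ℚ.*_) Q ⊞ (0ℚ ∷ (P ⊠ Q))

constant : ℚ → List ℚ
constant a = a ∷ []

ℚ[q] : RawRing 0ℓ 0ℓ
ℚ[q] = record
  { Carrier = List ℚ
  ; _≈_     = λ P Q → ∀ n → coeff P n ≡ coeff Q n
  ; _+_     = _⊞_
  ; _*_     = _⊠_
  ; -_      = List.map (λ a → ℚ.- a)
  ; 0#      = []
  ; 1#      = constant 1ℚ
  }

Polynomial : Set
Polynomial = RawRing.Carrier ℚ[q]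

indeterminate : Polynomial
indeterminate = 0ℚ ∷ 1ℚ ∷ []

-- In `evaluate` and in `PowerSeries`, ι is the structure map of a ℚ-algebra.

evaluate : ∀ {c ℓ} (A : RawRing c ℓ) → let open RawRing A in
           (ι : ℚ → Carrier) → Polynomial → Carrier → Carrier
evaluate A ι []      x = RawRing.0# A
evaluate A ι (a ∷ P) x = ι a + x * evaluate A ι P x
  where open RawRing A

natℚ : ℕ → ℚ
natℚ n = n ℚ× 1ℚ
  where open RawSemiringOps ℚ.+-*-rawSemiring renaming (_×_ to _ℚ×_)

evalℚ : Polynomial → ℚ → ℚ
evalℚ = evaluate ℚ.+-*-rawRing id

IsChromaticPolynomial : ∀ {n} → Graph n → Polynomial → Set
IsChromaticPolynomial G P = ∀ k → evalℚ P (natℚ k) ≡ natℚ (#properColourings G k)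

-- The polynomial counting proper colourings, obtained by colouring the vertices
-- one by one (see χ-isChromaticPolynomial).  Some vertices have already been
-- distributed over b colour classes with pairwise distinct colours, and
-- `F v j` says that the uncoloured vertex v has a neighbour in class j.

module _ {n b} (G : Graph (suc n)) (F : Fin (suc n) → Fin b → Set) where

  join : Fin b → Fin n → Fin b → Set
  join j v j′ = F (suc v) j′ ⊎ (j′ ≡ j × Adj G zero (suc v))

  new : Fin n → Fin (suc b) → Set
  new v zero    = Adj G zero (suc v)
  new v (suc j) = F (suc v) j

  module _ (F? : ∀ v j → Dec (F v j)) where

    join? : ∀ j v j′ → Dec (join j v j′)
    join? j v j′ = F? (suc v) j′ ⊎-dec ((j′ Fin.≟ j) ×-dec adj? G zero (suc v))

    new? : ∀ v j → Dec (new v j)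
    new? v zero    = adj? G zero (suc v)
    new? v (suc j) = F? (suc v) j

completions : ∀ {n b} (G : Graph n) (F : Fin n → Fin b → Set) →
              (∀ v j → Dec (F v j)) → Polynomial
completions {zero}          G F F? = constant 1ℚ
completions {suc n} {b = b} G F F? =
  RawSemiringOps.sum (RawRing.rawSemiring ℚ[q])
    (λ j → if does (F? zero j) then []
           else completions (pullback suc G) (join G F j) (join? G F F? j))
  ⊞ (ℚ.- natℚ b ∷ 1ℚ ∷ [])
    ⊠ completions (pullback suc G) (new G F) (new? G F F?)

χ : ∀ {n} → Graph n → Polynomial
χ G = completions {b = 0} G (λ _ ()) (λ _ ())

module Existence where

  private module ∑ℚ = SemiringSum (CommutativeRing.semiring ℚ.+-*-commutativeRing)
  open ∑ℚ using (sum; sum-cong-≗; ∑-comm; ∑-distrib-+; sum-replicate-zero)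

  open +-*-Solver using (solve; _:+_; _:*_; :-_; _:=_; con)

  evalℚ-⊞ : ∀ P Q x → evalℚ (P ⊞ Q) x ≡ evalℚ P x ℚ.+ evalℚ Q x
  evalℚ-⊞ []      Q       x = sym (ℚ.+-identityˡ _)
  evalℚ-⊞ (a ∷ P) []      x = sym (ℚ.+-identityʳ _)
  evalℚ-⊞ (a ∷ P) (b ∷ Q) x =
    trans (cong (λ z → (a ℚ.+ b) ℚ.+ x ℚ.* z) (evalℚ-⊞ P Q x))
          (solve 5 (λ a b x P Q → (a :+ b) :+ x :* (P :+ Q)
                                := (a :+ x :* P) :+ (b :+ x :* Q))
             refl a b x (evalℚ P x) (evalℚ Q x))

  evalℚ-scale : ∀ a Q x → evalℚ (List.map (a ℚ.*_) Q) x ≡ a ℚ.* evalℚ Q x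
  evalℚ-scale a []      x = sym (ℚ.*-zeroʳ a)
  evalℚ-scale a (b ∷ Q) x =
    trans (cong (λ z → a ℚ.* b ℚ.+ x ℚ.* z) (evalℚ-scale a Q x))
          (solve 4 (λ a b x Q → a :* b :+ x :* (a :* Q) := a :* (b :+ x :* Q))
             refl a b x (evalℚ Q x))

  evalℚ-⊠ : ∀ P Q x → evalℚ (P ⊠ Q) x ≡ evalℚ P x ℚ.* evalℚ Q x
  evalℚ-⊠ []      Q x = sym (ℚ.*-zeroˡ (evalℚ Q x))
  evalℚ-⊠ (a ∷ P) Q x = begin
    evalℚ (List.map (a ℚ.*_) Q ⊞ (0ℚ ∷ (P ⊠ Q))) x
      ≡⟨ evalℚ-⊞ (List.map (a ℚ.*_) Q) _ x ⟩
    evalℚ (List.map (a ℚ.*_) Q) x ℚ.+ (0ℚ ℚ.+ x ℚ.* evalℚ (P ⊠ Q) x)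
      ≡⟨ cong₂ (λ y z → y ℚ.+ (0ℚ ℚ.+ x ℚ.* z)) (evalℚ-scale a Q x) (evalℚ-⊠ P Q x) ⟩
    a ℚ.* evalℚ Q x ℚ.+ (0ℚ ℚ.+ x ℚ.* (evalℚ P x ℚ.* evalℚ Q x))
      ≡⟨ solve 4 (λ a x P Q → a :* Q :+ (con 0ℚ :+ x :* (P :* Q)) := (a :+ x :* P) :* Q)
           refl a x (evalℚ P x) (evalℚ Q x) ⟩
    (a ℚ.+ x ℚ.* evalℚ P x) ℚ.* evalℚ Q x ∎
    where open ≡-Reasoning

  evalℚ-sum : ∀ {b} (P : Fin b → Polynomial) x →
              evalℚ (RawSemiringOps.sum (RawRing.rawSemiring ℚ[q]) P) x ≡ sum (λ j → evalℚ (P j) x)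
  evalℚ-sum {zero}  P x = refl
  evalℚ-sum {suc b} P x = trans (evalℚ-⊞ (P zero) _ x) (cong (evalℚ (P zero) x ℚ.+_) (evalℚ-sum (P ∘ suc) x))

  natℚ-+ : ∀ m n → natℚ (m ℕ.+ n) ≡ natℚ m ℚ.+ natℚ n
  natℚ-+ zero    n = sym (ℚ.+-identityˡ _)
  natℚ-+ (suc m) n = trans (cong (1ℚ ℚ.+_) (natℚ-+ m n)) (sym (ℚ.+-assoc 1ℚ (natℚ m) (natℚ n)))

  sum-const : ∀ n a → sum {n} (λ _ → a) ≡ natℚ n ℚ.* a
  sum-const zero    a = sym (ℚ.*-zeroˡ a)
  sum-const (suc n) a = trans (cong (a ℚ.+_) (sum-const n a))
    (solve 2 (λ a n → a :+ n :* a := (con 1ℚ :+ n) :* a) refl a (natℚ n))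

  sum-zero : ∀ {n} (t : Fin n → ℚ) → (∀ i → t i ≡ 0ℚ) → sum t ≡ 0ℚ
  sum-zero {n} t t≡0 = trans (sum-cong-≗ t≡0) (sum-replicate-zero n)

  sum-single : ∀ {n} (t : Fin n → ℚ) i → (∀ j → j ≢ i → t j ≡ 0ℚ) → sum t ≡ t i
  sum-single t zero    t≡0 =
    trans (cong (t zero ℚ.+_) (sum-zero (t ∘ suc) λ j → t≡0 (suc j) λ ())) (ℚ.+-identityʳ _)
  sum-single t (suc i) t≡0 =
    trans (cong₂ ℚ._+_ (t≡0 zero λ ())
                 (sum-single (t ∘ suc) i λ j j≢i → t≡0 (suc j) (j≢i ∘ Fin.suc-injective)))
          (ℚ.+-identityˡ _)

  module _ {b k} (φ : Fin b → Fin k) (inj : Injective _≡_ _≡_ φ) where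

    sum-supported : (h : Fin k → ℚ) → (∀ c → (∀ j → c ≢ φ j) → h c ≡ 0ℚ) →
                    sum h ≡ sum (h ∘ φ)
    sum-supported h h≡0 = begin
      sum h                              ≡⟨ sum-cong-≗ row ⟨
      sum (λ c → sum (λ j → e c j))      ≡⟨ ∑-comm e ⟩
      sum (λ j → sum (λ c → e c j))      ≡⟨ sum-cong-≗ column ⟩
      sum (h ∘ φ)                        ∎
      where
      open ≡-Reasoning

      e : Fin k → Fin b → ℚ
      e c j = if does (c Fin.≟ φ j) then h c else 0ℚ

      e-hit : ∀ c j → c ≡ φ j → e c j ≡ h c
      e-hit c j c≡φj with c Fin.≟ φ j
      ... | yes _    = refl
      ... | no  c≢φj = contradiction c≡φj c≢φj

      e-miss : ∀ c j → c ≢ φ j → e c j ≡ 0ℚ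
      e-miss c j c≢φj with c Fin.≟ φ j
      ... | yes c≡φj = contradiction c≡φj c≢φj
      ... | no  _    = refl

      row : ∀ c → sum (e c) ≡ h c
      row c with Fin.any? (λ j → c Fin.≟ φ j)
      ... | yes (j , c≡φj) =
        trans (sum-single (e c) j λ j′ j′≢j →
                e-miss c j′ λ c≡φj′ → j′≢j (inj (trans (sym c≡φj′) c≡φj)))
              (e-hit c j c≡φj)
      ... | no ∄j =
        trans (sum-zero (e c) λ j → e-miss c j λ c≡φj → ∄j (j , c≡φj))
              (sym (h≡0 c λ j c≡φj → ∄j (j , c≡φj)))

      column : ∀ j → sum (λ c → e c j) ≡ h (φ j)
      column j = trans (sum-single (λ c → e c j) (φ j) λ c → e-miss c j) (e-hit (φ j) j refl)

    sum-split : ∀ (g : Fin k → ℚ) a → (∀ c → (∀ j → c ≢ φ j) → g c ≡ a) →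
                sum g ≡ sum (g ∘ φ) ℚ.+ (natℚ k ℚ.- natℚ b) ℚ.* a
    sum-split g a g≡a = begin
      sum g
        ≡⟨ sum-cong-≗ (λ c → solve 2 (λ g a → g := (g :+ :- a) :+ a) refl (g c) a) ⟩
      sum (λ c → h c ℚ.+ a)
        ≡⟨ ∑-distrib-+ h (λ _ → a) ⟩
      sum h ℚ.+ sum {k} (λ _ → a)
        ≡⟨ cong₂ ℚ._+_ (sum-supported h h≡0) (sum-const k a) ⟩
      sum (h ∘ φ) ℚ.+ natℚ k ℚ.* a
        ≡⟨ cong (ℚ._+ natℚ k ℚ.* a) (∑-distrib-+ (g ∘ φ) (λ _ → ℚ.- a)) ⟩
      (sum (g ∘ φ) ℚ.+ sum {b} (λ _ → ℚ.- a)) ℚ.+ natℚ k ℚ.* a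
        ≡⟨ cong (λ z → (sum (g ∘ φ) ℚ.+ z) ℚ.+ natℚ k ℚ.* a) (sum-const b (ℚ.- a)) ⟩
      (sum (g ∘ φ) ℚ.+ natℚ b ℚ.* (ℚ.- a)) ℚ.+ natℚ k ℚ.* a
        ≡⟨ solve 4 (λ s k b a → (s :+ b :* (:- a)) :+ k :* a := s :+ (k :+ :- b) :* a)
             refl (sum (g ∘ φ)) (natℚ k) (natℚ b) a ⟩
      sum (g ∘ φ) ℚ.+ (natℚ k ℚ.- natℚ b) ℚ.* a ∎
      where
      open ≡-Reasoning
      h : Fin k → ℚ
      h c = g c ℚ.- a

      h≡0 : ∀ c → (∀ j → c ≢ φ j) → h c ≡ 0ℚ
      h≡0 c c∉φ = trans (cong (ℚ._- a) (g≡a c c∉φ)) (ℚ.+-inverseʳ a)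

  count : ∀ {A : Set} {P : A → Set} → Unary.Decidable P → List A → ℕ
  count P? xs = length (filter P? xs)

  count-++ : ∀ {A : Set} {P : A → Set} (P? : Unary.Decidable P) xs ys →
             count P? (xs List.++ ys) ≡ count P? xs ℕ.+ count P? ys
  count-++ P? xs ys =
    trans (cong length (List.filter-++ P? xs ys)) (List.length-++ (filter P? xs))

  count-map : ∀ {A B : Set} {P : B → Set} (P? : Unary.Decidable P) (f : A → B) xs →
              count P? (List.map f xs) ≡ count (P? ∘ f) xs
  count-map P? f []       = refl
  count-map P? f (x ∷ xs) with does (P? (f x))
  ... | true  = cong suc (count-map P? f xs)
  ... | false = count-map P? f xs

  count-≐ : ∀ {A : Set} {P Q : A → Set} (P? : Unary.Decidable P) (Q? : Unary.Decidable Q) →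
            (∀ x → P x → Q x) → (∀ x → Q x → P x) → ∀ xs → count P? xs ≡ count Q? xs
  count-≐ P? Q? P⇒Q Q⇒P xs =
    cong length (List.filter-≐ P? Q? ((λ {x} → P⇒Q x) , (λ {x} → Q⇒P x)) xs)

  count-none : ∀ {A : Set} {P : A → Set} (P? : Unary.Decidable P) →
               (∀ x → ¬ P x) → ∀ xs → count P? xs ≡ 0
  count-none P? ¬P []       = refl
  count-none P? ¬P (x ∷ xs) =
    trans (cong length (List.filter-reject P? (¬P x))) (count-none P? ¬P xs)

  count-product : ∀ {A B C : Set} {P : C → Set} (P? : Unary.Decidable P)
                  (_⊕_ : A → B → C) {k} (f : Fin k → A) ys →
                  natℚ (count P? (cartesianProductWith _⊕_ (List.tabulate f) ys)) ≡
                  sum (λ c → natℚ (count (λ y → P? (f c ⊕ y)) ys))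
  count-product P? _⊕_ {zero}  f ys = refl
  count-product P? _⊕_ {suc k} f ys = begin
    natℚ (count P? (List.map (f zero ⊕_) ys List.++ rest))
      ≡⟨ cong natℚ (count-++ P? (List.map (f zero ⊕_) ys) rest) ⟩
    natℚ (count P? (List.map (f zero ⊕_) ys) ℕ.+ count P? rest)
      ≡⟨ natℚ-+ (count P? (List.map (f zero ⊕_) ys)) _ ⟩
    natℚ (count P? (List.map (f zero ⊕_) ys)) ℚ.+ natℚ (count P? rest)
      ≡⟨ cong₂ (λ m z → natℚ m ℚ.+ z) (count-map P? (f zero ⊕_) ys)
               (count-product P? _⊕_ (f ∘ suc) ys) ⟩
    sum (λ c → natℚ (count (λ y → P? (f c ⊕ y)) ys)) ∎
    where
    open ≡-Reasoning
    rest = cartesianProductWith _⊕_ (List.tabulate (f ∘ suc)) ys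

  Completes : ∀ {n b k} → Graph n → (Fin n → Fin b → Set) → (Fin b → Fin k) →
              Vec (Fin k) n → Set
  Completes G F φ f = Proper G f × (∀ v j → F v j → lookup f v ≢ φ j)

  completes? : ∀ {n b k} (G : Graph n) {F : Fin n → Fin b → Set} → (∀ v j → Dec (F v j)) →
               (φ : Fin b → Fin k) → Unary.Decidable (Completes G F φ)
  completes? G F? φ f = proper? G f ×-dec
    Fin.all? λ v → Fin.all? λ j → F? v j →-dec ¬? (lookup f v Fin.≟ φ j)

  module _ {n b k} (G : Graph (suc n)) (F : Fin (suc n) → Fin b → Set)
           (φ : Fin b → Fin k) (inj : Injective _≡_ _≡_ φ) where

    proper-∷ : ∀ (c : Fin k) f → Proper (pullback suc G) f →
               (∀ v → Adj G zero (suc v) → lookup f v ≢ c) → Proper G (c ∷ f)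
    proper-∷ c f pr ok zero    zero    a = contradiction a (irrefl G refl)
    proper-∷ c f pr ok zero    (suc v) a = ok v a ∘ sym
    proper-∷ c f pr ok (suc u) zero    a = ok u (symm G a)
    proper-∷ c f pr ok (suc u) (suc v) a = pr u v a

    old⇒ : ∀ j f → Completes G F φ (φ j ∷ f) → Completes (pullback suc G) (join G F j) φ f
    old⇒ j f (pr , ok) = (λ u v → pr (suc u) (suc v)) ,
      λ { v j′ (inj₁ Fvj′)       → ok (suc v) j′ Fvj′
        ; v j′ (inj₂ (refl , a)) → pr (suc v) zero (symm G a) }

    old⇐ : ∀ j → ¬ F zero j →
           ∀ f → Completes (pullback suc G) (join G F j) φ f → Completes G F φ (φ j ∷ f)
    old⇐ j ¬F0j f (pr , ok) = proper-∷ (φ j) f pr (λ v a → ok v j (inj₂ (refl , a))) ,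
      λ { zero    j′ F0j′ φj≡φj′ → ¬F0j (subst (F zero) (sym (inj φj≡φj′)) F0j′)
        ; (suc v) j′ Fvj′        → ok v j′ (inj₁ Fvj′) }

    new⇒ : ∀ c f → Completes G F φ (c ∷ f) →
           Completes (pullback suc G) (new G F) (c Vector.∷ φ) f
    new⇒ c f (pr , ok) = (λ u v → pr (suc u) (suc v)) ,
      λ { v zero    a   → pr (suc v) zero (symm G a)
        ; v (suc j) Fvj → ok (suc v) j Fvj }

    new⇐ : ∀ c → (∀ j → c ≢ φ j) →
           ∀ f → Completes (pullback suc G) (new G F) (c Vector.∷ φ) f → Completes G F φ (c ∷ f)
    new⇐ c c∉φ f (pr , ok) = proper-∷ c f pr (λ v → ok v zero) ,
      λ { zero    j _   → c∉φ j
        ; (suc v) j Fvj → ok v (suc j) Fvj }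

    ∷-injective : ∀ c → (∀ j → c ≢ φ j) → Injective _≡_ _≡_ (c Vector.∷ φ)
    ∷-injective c c∉φ {zero}  {zero}  _  = refl
    ∷-injective c c∉φ {zero}  {suc j} eq = contradiction eq (c∉φ j)
    ∷-injective c c∉φ {suc i} {zero}  eq = contradiction (sym eq) (c∉φ i)
    ∷-injective c c∉φ {suc i} {suc j} eq = cong suc (inj eq)

  completions-correct :
    ∀ {n b k} (G : Graph n) (F : Fin n → Fin b → Set) (F? : ∀ v j → Dec (F v j)) →
    (φ : Fin b → Fin k) → Injective _≡_ _≡_ φ →
    evalℚ (completions G F F?) (natℚ k) ≡
    natℚ (count (completes? G F? φ) (vectors (allFin k) n))
  completions-correct {zero}  {b} {k} G F F? φ inj = begin
    1ℚ ℚ.+ natℚ k ℚ.* 0ℚ  ≡⟨ cong (1ℚ ℚ.+_) (ℚ.*-zeroʳ (natℚ k)) ⟩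
    natℚ 1                ≡⟨ cong (natℚ ∘ length) (List.filter-accept (completes? G F? φ) {x = []} {xs = []} ((λ ()) , λ ())) ⟨
    natℚ (count (completes? G F? φ) ([] ∷ [])) ∎
    where open ≡-Reasoning
  completions-correct {suc n} {b} {k} G F F? φ inj = begin
    evalℚ (completions G F F?) (natℚ k)
      ≡⟨ evalℚ-⊞ (RawSemiringOps.sum (RawRing.rawSemiring ℚ[q]) old) _ (natℚ k) ⟩
    evalℚ (RawSemiringOps.sum (RawRing.rawSemiring ℚ[q]) old) (natℚ k) ℚ.+
      evalℚ ((ℚ.- natℚ b ∷ 1ℚ ∷ []) ⊠ fresh) (natℚ k)
      ≡⟨ cong₂ ℚ._+_ (evalℚ-sum old (natℚ k))
                     (evalℚ-⊠ (ℚ.- natℚ b ∷ 1ℚ ∷ []) fresh (natℚ k)) ⟩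
    sum (λ j → evalℚ (old j) (natℚ k)) ℚ.+
      (ℚ.- natℚ b ℚ.+ natℚ k ℚ.* (1ℚ ℚ.+ natℚ k ℚ.* 0ℚ)) ℚ.* evalℚ fresh (natℚ k)
      ≡⟨ cong₂ ℚ._+_ (sum-cong-≗ old≡)
           (cong (ℚ._* evalℚ fresh (natℚ k))
             (solve 2 (λ b k → :- b :+ k :* (con 1ℚ :+ k :* con 0ℚ) := k :+ :- b)
                refl (natℚ b) (natℚ k))) ⟩
    sum (g ∘ φ) ℚ.+ (natℚ k ℚ.- natℚ b) ℚ.* evalℚ fresh (natℚ k)
      ≡⟨ sum-split φ inj g (evalℚ fresh (natℚ k)) new≡ ⟨
    sum g
      ≡⟨ count-product (completes? G F? φ) _∷_ id (vectors (allFin k) n) ⟨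
    natℚ (count (completes? G F? φ) (vectors (allFin k) (suc n))) ∎
    where
    open ≡-Reasoning

    old : Fin b → Polynomial
    old j = if does (F? zero j) then []
            else completions (pullback suc G) (join G F j) (join? G F F? j)

    fresh : Polynomial
    fresh = completions (pullback suc G) (new G F) (new? G F F?)

    g : Fin k → ℚ
    g c = natℚ (count (λ f → completes? G F? φ (c ∷ f)) (vectors (allFin k) n))

    old≡ : ∀ j → evalℚ (old j) (natℚ k) ≡ g (φ j)
    old≡ j with F? zero j
    ... | yes F0j = cong natℚ (sym (count-none (λ f → completes? G F? φ (φ j ∷ f))
                      (λ f comp → proj₂ comp zero j F0j refl) (vectors (allFin k) n)))
    ... | no ¬F0j = trans
      (completions-correct (pullback suc G) (join G F j) (join? G F F? j) φ inj)
      (cong natℚ (count-≐ (completes? (pullback suc G) (join? G F F? j) φ)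
                           (λ f → completes? G F? φ (φ j ∷ f))
                           (old⇐ G F φ inj j ¬F0j) (old⇒ G F φ inj j) (vectors (allFin k) n)))

    new≡ : ∀ c → (∀ j → c ≢ φ j) → g c ≡ evalℚ fresh (natℚ k)
    new≡ c c∉φ = trans
      (cong natℚ (count-≐ (λ f → completes? G F? φ (c ∷ f))
                           (completes? (pullback suc G) (new? G F F?) (c Vector.∷ φ))
                           (new⇒ G F φ inj c) (new⇐ G F φ inj c c∉φ) (vectors (allFin k) n)))
      (sym (completions-correct (pullback suc G) (new G F) (new? G F F?) (c Vector.∷ φ)
              (∷-injective G F φ inj c c∉φ)))

χ-isChromaticPolynomial : ∀ {n} (G : Graph n) → IsChromaticPolynomial G (χ G)
χ-isChromaticPolynomial {n} G k = trans
  (completions-correct G (λ _ ()) (λ _ ()) (λ ()) (λ { {()} }))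
  (cong natℚ (count-≐ (completes? G (λ _ ()) (λ ())) (proper? G)
                (λ _ → proj₁) (λ _ pr → pr , λ _ ()) (vectors (allFin k) n)))
  where open Existence

invFactorial : ℕ → ℚ
invFactorial n = (ℤ.1ℤ ℚ./ (n !)) {{n ℕ.!≢0}}

below : ∀ {p} → Vec ℕ p → List (Vec ℕ p)
below []      = [] ∷ []
below (n ∷ α) = cartesianProductWith _∷_ (upTo (suc n)) (below α)

module PowerSeries {c ℓ} (A : RawRing c ℓ) (ι : ℚ → RawRing.Carrier A) where

  open RawRing A

  -- `f α` is the coefficient of x₁^α₁ ⋯ xₚ^αₚ.

  Series : ℕ → Set c
  Series p = Vec ℕ p → Carrier

  ∑ : List Carrier → Carrier
  ∑ = foldr _+_ 0#

  monomial : ∀ {p} → Vec ℕ p → Series p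
  monomial α β = if does (Vec.≡-dec ℕ._≟_ α β) then 1# else 0#

  seriesRing : ℕ → RawRing c ℓ
  seriesRing p = record
    { Carrier = Series p
    ; _≈_     = λ f g → ∀ α → f α ≈ g α
    ; _+_     = λ f g α → f α + g α
    ; _*_     = λ f g α → ∑ (List.map (λ β → f β * g (zipWith _∸_ α β)) (below α))
    ; -_      = λ f α → - f α
    ; 0#      = λ _ → 0#
    ; 1#      = monomial (replicate p 0)
    }

  module _ {p : ℕ} where
    private module S = RawRing (seriesRing p)
    open RawSemiringOps S.rawSemiring using (_^_)

    infix 4 _≋_
    _≋_ : Series p → Series p → Set ℓ
    _≋_ = S._≈_

    X : Fin p → Series p
    X i = monomial (replicate p 0 [ i ]≔ 1)

    -- f ^ˢ a is exp (a · log f), as f ^ k is only available for natural k.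
    -- Truncating the exponential and logarithm series at the total degree of α
    -- is harmless for `exp f` when f has constant term 0, and for `log f` when
    -- f has constant term 1; they are used only for such f.

    exp : Series p → Series p
    exp f α = ∑ (applyUpTo (λ k → ι (invFactorial k) * (f ^ k) α) (suc (Vec.sum α)))

    log : Series p → Series p
    log f α = ∑ (applyUpTo (λ k → ι ((ℤ.-1ℤ ℤ.^ k) ℚ./ suc k) * ((f S.+ (S.- S.1#)) ^ suc k) α)
                           (Vec.sum α))

    infixr 8 _^ˢ_
    _^ˢ_ : Series p → Carrier → Series p
    f ^ˢ a = exp (λ α → a * log f α)

    B : Graph p → Series p
    B H = foldr S._+_ S.0# (List.map term (Ind H))
      where
      term : Subset p → Series p
      term I = foldr S._*_ S.1#
        (List.map (λ i → exp (X i) S.+ (S.- S.1#)) (filter (_∈? I) (allFin p)))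

    -- ∑ a(λ) ∏ᵢ xᵢ^λᵢ / λᵢ!, summed over λ
    egf : (Vec ℕ p → Carrier) → Series p
    egf a l = a l * ι (Vec.foldr′ ℚ._*_ 1ℚ (Vec.map invFactorial l))

{-# OPTIONS --safe #-}

-- Both sides have coefficients polynomial in q, and every operation involved is
-- preserved by evaluation at q, so it is enough to work over ℚ with q = k a natural
-- number.  There f ^ˢ k = f ^ k, because with θᵢ = xᵢ ∂/∂xᵢ both sides solve
-- f · θᵢ g = k · g · θᵢ f, whose solution is determined by its constant term.
--
-- The coefficient of x^μ in B_H is ∏ 1/μᵢ! if the support of μ is independent, and 0
-- otherwise.  A colouring of H[λ] is proper iff each of its k colour classes meets an
-- independent set of blocks.  Colouring the vertices one by one, the choice of the
-- colour of a vertex in block i corresponds to the choice of the factor that ∂/∂xᵢ acts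
-- on when it is applied to a product of k copies of B_H by the Leibniz rule.
module Submission where

open import Defs
open import Algebra.Bundles using (CommutativeRing; RawRing)
open import Algebra.Morphism.Structures using (module RingMorphisms)
open import Data.Nat.Base using (ℕ)
open import Data.Product.Base using (_×_)
open import Data.Rational.Base using (ℚ)
open import Data.Rational.Properties using (+-*-rawRing)
open import Data.Vec.Base using (replicate)
open import Level using (Level)

import Algebra.Definitions.RawSemiring as RawSemiringOps
import Algebra.Morphism.Construct.Identity as Identity
import Algebra.Properties.Group as GroupProperties
import Algebra.Properties.Ring as RingProperties
import Algebra.Properties.Semiring.Sum as SemiringSum
import Algebra.Solver.Ring.NaturalCoefficients.Default as NaturalCoefficients
open import Data.Bool.Base using (true; false; if_then_else_)
open import Data.Fin.Base using (Fin; zero; suc; splitAt)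
import Data.Fin.Properties as Fin
open import Data.Fin.Subset using (Subset; inside; outside; _∈_; _∪_; ⁅_⁆; ⊥)
open import Data.Fin.Subset.Properties
  using (_∈?_; ∪-identityˡ; ∪-identityʳ; ∪-assoc; x∈p∪q⁻; x∈p∪q⁺; x∈⁅x⁆; x∈⁅y⁆⇒x≡y; ∉⊥)
import Data.Integer.Base as ℤ
import Data.Integer.Properties as ℤ
open import Data.Integer.Solver using () renaming (module +-*-Solver to ℤ-Solver)
open import Data.List.Base as List
  using (List; []; _∷_; allFin; applyUpTo; cartesianProductWith; filter; foldr; upTo)
import Data.List.Properties as List
open import Data.Nat.Base as ℕ using (zero; suc; _∸_; _!)
import Data.Nat.Properties as ℕ
open import Data.Product.Base using (_,_; ∃)
open import Data.Rational.Base as ℚ using (0ℚ; 1ℚ)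
import Data.Rational.Properties as ℚ
open import Data.Rational.Solver using (module +-*-Solver)
import Data.Rational.Unnormalised.Base as ℚᵘ
import Data.Rational.Unnormalised.Properties as ℚᵘ
open import Data.Sum.Base using (_⊎_; inj₁; inj₂)
open import Data.Vec.Base as Vec using (Vec; []; _∷_; head; tail; lookup; _[_]≔_; _[_]%=_)
import Data.Vec.Properties as Vec
open import Data.Vec.Relation.Unary.All using (All; all?)
import Data.Vec.Relation.Unary.All.Properties as All
open import Function.Base using (id; _∘_)
open import Relation.Binary.PropositionalEquality
  using (_≡_; _≢_; refl; sym; trans; cong; cong₂; subst; module ≡-Reasoning)
open import Relation.Nullary.Decidable using (does; yes; no; dec-true)
open import Relation.Nullary.Negation using (¬_; contradiction)
import Relation.Unary as Unary

-- Two features of the definitions resist direct algebra: the product of series sums over all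
-- exponents below a given one, and `exp` and `log` are sums whose length varies with the exponent.
-- The product is therefore replaced by a recursion on the first exponent. Modulo terms of degree at
-- least N, `exp` and `log` become partial sums of one common length in a commutative ring. The
-- differential equations carry a factor f on the left, so no inverse of f is ever formed; that f
-- has constant term 1 is what lets them determine their solution degree by degree. Two derivations
-- are in use. θᵢ keeps the exponent and hence respects truncation by degree, which suits `exp` and
-- `log`; ∂ᵢ removes one unit from an exponent, which suits the removal of one vertex from a block.

-- Natural numbers, inverse factorials and signs as rationals

module Rational where

  natℚ-nonNeg : ∀ n → 0ℚ ℚ.≤ natℚ n
  natℚ-nonNeg zero    = ℚ.≤-refl
  natℚ-nonNeg (suc n) = ℚ.+-mono-≤ (ℚ.nonNegative⁻¹ 1ℚ) (natℚ-nonNeg n)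

  natℚ-suc≢0 : ∀ n → natℚ (suc n) ≢ 0ℚ
  natℚ-suc≢0 n eq = ℚ.<-irrefl (sym eq) (ℚ.+-mono-<-≤ (ℚ.positive⁻¹ 1ℚ) (natℚ-nonNeg n))

  *-cancelˡ-0 : ∀ {r s} → r ≢ 0ℚ → r ℚ.* s ≡ 0ℚ → s ≡ 0ℚ
  *-cancelˡ-0 {r} {s} r≢0 rs≡0 = begin
    s                       ≡⟨ ℚ.*-identityˡ s ⟨
    1ℚ ℚ.* s                ≡⟨ cong (ℚ._* s) (ℚ.*-inverseˡ r) ⟨
    (ℚ.1/ r) ℚ.* r ℚ.* s    ≡⟨ ℚ.*-assoc (ℚ.1/ r) r s ⟩
    (ℚ.1/ r) ℚ.* (r ℚ.* s)  ≡⟨ cong ((ℚ.1/ r) ℚ.*_) rs≡0 ⟩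
    (ℚ.1/ r) ℚ.* 0ℚ         ≡⟨ ℚ.*-zeroʳ (ℚ.1/ r) ⟩
    0ℚ                      ∎
    where
    open ≡-Reasoning
    instance r-nonZero = ℚ.≢-nonZero r≢0

  toℚᵘ-natℚ : ∀ n → ℚ.toℚᵘ (natℚ n) ℚᵘ.≃ ℚᵘ.mkℚᵘ (ℤ.+ n) 0
  toℚᵘ-natℚ zero    = ℚᵘ.≃-refl
  toℚᵘ-natℚ (suc n) = begin-equality
    ℚ.toℚᵘ (1ℚ ℚ.+ natℚ n)              ≃⟨ ℚ.toℚᵘ-homo-+ 1ℚ (natℚ n) ⟩
    ℚᵘ.1ℚᵘ ℚᵘ.+ ℚ.toℚᵘ (natℚ n)         ≃⟨ ℚᵘ.+-congʳ ℚᵘ.1ℚᵘ (toℚᵘ-natℚ n) ⟩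
    ℚᵘ.1ℚᵘ ℚᵘ.+ ℚᵘ.mkℚᵘ (ℤ.+ n) 0
      ≃⟨ ℚᵘ.*≡* (solve 1 (λ n → (con ℤ.1ℤ :* con ℤ.1ℤ :+ n :* con ℤ.1ℤ) :* con ℤ.1ℤ
                              := (con ℤ.1ℤ :+ n) :* (con ℤ.1ℤ)) refl (ℤ.+ n)) ⟩
    ℚᵘ.mkℚᵘ (ℤ.+ suc n) 0               ∎
    where
    open ℚᵘ.≤-Reasoning
    open ℤ-Solver

  -- Rationals are stored in lowest terms, so the cancellation is carried out on unnormalised
  -- fractions, where it is a cross-multiplication.
  /-natℚ : ∀ z d .{{_ : ℕ.NonZero d}} → (z ℚ./ d) ℚ.* natℚ d ≡ z ℚ./ 1
  /-natℚ z zero {{d≢0}} = contradiction refl (ℕ.≢-nonZero⁻¹ 0 {{d≢0}})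
  /-natℚ z (suc n) = ℚ.toℚᵘ-injective (begin-equality
    ℚ.toℚᵘ ((z ℚ./ suc n) ℚ.* natℚ (suc n))
      ≃⟨ ℚ.toℚᵘ-homo-* (z ℚ./ suc n) (natℚ (suc n)) ⟩
    ℚ.toℚᵘ (z ℚ./ suc n) ℚᵘ.* ℚ.toℚᵘ (natℚ (suc n))
      ≃⟨ ℚᵘ.*-cong (ℚ.toℚᵘ-fromℚᵘ (ℚᵘ.mkℚᵘ z n)) (toℚᵘ-natℚ (suc n)) ⟩
    ℚᵘ.mkℚᵘ z n ℚᵘ.* ℚᵘ.mkℚᵘ (ℤ.+ suc n) 0
      ≃⟨ ℚᵘ.*≡* (trans (ℤ.*-identityʳ _) (cong (λ m → z ℤ.* ℤ.+ suc m) (sym (ℕ.*-identityʳ n)))) ⟩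
    ℚᵘ.mkℚᵘ z 0
      ≃⟨ ℚ.toℚᵘ-fromℚᵘ (ℚᵘ.mkℚᵘ z 0) ⟨
    ℚ.toℚᵘ (z ℚ./ 1) ∎)
    where open ℚᵘ.≤-Reasoning

  natℚ-* : ∀ m n → natℚ (m ℕ.* n) ≡ natℚ m ℚ.* natℚ n
  natℚ-* zero    n = sym (ℚ.*-zeroˡ (natℚ n))
  natℚ-* (suc m) n = begin
    natℚ (n ℕ.+ m ℕ.* n)             ≡⟨ Existence.natℚ-+ n (m ℕ.* n) ⟩
    natℚ n ℚ.+ natℚ (m ℕ.* n)        ≡⟨ cong (natℚ n ℚ.+_) (natℚ-* m n) ⟩
    natℚ n ℚ.+ natℚ m ℚ.* natℚ n
      ≡⟨ solve 2 (λ m n → n :+ m :* n := (con 1ℚ :+ m) :* n) refl (natℚ m) (natℚ n) ⟩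
    natℚ (suc m) ℚ.* natℚ n          ∎
    where
    open ≡-Reasoning
    open +-*-Solver

  *-cancelˡ : ∀ {r} → r ≢ 0ℚ → ∀ {s t} → r ℚ.* s ≡ r ℚ.* t → s ≡ t
  *-cancelˡ {r} r≢0 {s} {t} rs≡rt = begin
    s                    ≡⟨ solve 2 (λ s t → s := (s :+ :- t) :+ t) refl s t ⟩
    (s ℚ.- t) ℚ.+ t      ≡⟨ cong (ℚ._+ t) (*-cancelˡ-0 r≢0 r[s-t]≡0) ⟩
    0ℚ ℚ.+ t             ≡⟨ ℚ.+-identityˡ t ⟩
    t                    ∎
    where
    open ≡-Reasoning
    open +-*-Solver
    r[s-t]≡0 : r ℚ.* (s ℚ.- t) ≡ 0ℚ
    r[s-t]≡0 = begin
      r ℚ.* (s ℚ.- t)        ≡⟨ solve 3 (λ r s t → r :* (s :+ :- t) := r :* s :+ :- (r :* t)) refl r s t ⟩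
      r ℚ.* s ℚ.- r ℚ.* t    ≡⟨ cong (ℚ._- r ℚ.* t) rs≡rt ⟩
      r ℚ.* t ℚ.- r ℚ.* t    ≡⟨ ℚ.+-inverseʳ (r ℚ.* t) ⟩
      0ℚ                     ∎

  -- Multiplied by `n !`, both sides become 1. Beyond the value at 0, this recurrence is all that is
  -- used about inverse factorials.
  invFactorial-suc : ∀ n → natℚ (suc n) ℚ.* invFactorial (suc n) ≡ invFactorial n
  invFactorial-suc n = *-cancelˡ {natℚ (n !)} n!≢0 (begin
    natℚ (n !) ℚ.* (natℚ (suc n) ℚ.* invFactorial (suc n))
      ≡⟨ solve 3 (λ a b c → a :* (b :* c) := c :* (b :* a))
           refl (natℚ (n !)) (natℚ (suc n)) (invFactorial (suc n)) ⟩
    invFactorial (suc n) ℚ.* (natℚ (suc n) ℚ.* natℚ (n !))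
      ≡⟨ cong (invFactorial (suc n) ℚ.*_) (natℚ-* (suc n) (n !)) ⟨
    invFactorial (suc n) ℚ.* natℚ (suc n !)
      ≡⟨ /-natℚ ℤ.1ℤ (suc n !) {{suc n ℕ.!≢0}} ⟩
    1ℚ
      ≡⟨ /-natℚ ℤ.1ℤ (n !) {{n ℕ.!≢0}} ⟨
    invFactorial n ℚ.* natℚ (n !)
      ≡⟨ ℚ.*-comm (invFactorial n) _ ⟩
    natℚ (n !) ℚ.* invFactorial n ∎)
    where
    open ≡-Reasoning
    open +-*-Solver
    n!≢0 : natℚ (n !) ≢ 0ℚ
    n!≢0 with n ! in eq
    ... | zero  = contradiction eq (ℕ.≢-nonZero⁻¹ (n !) {{n ℕ.!≢0}})
    ... | suc m = natℚ-suc≢0 m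

  -- The power of -1 in the form that `/-natℚ` leaves when the denominator of a coefficient of the
  -- logarithm is cancelled.
  sign : ℕ → ℚ
  sign n = (ℤ.-1ℤ ℤ.^ n) ℚ./ 1

  sign-suc : ∀ n → sign (suc n) ≡ ℚ.- sign n
  sign-suc n = ℚ.toℚᵘ-injective (begin-equality
    ℚ.toℚᵘ (sign (suc n))              ≃⟨ ℚ.toℚᵘ-fromℚᵘ _ ⟩
    ℚᵘ.mkℚᵘ (ℤ.-1ℤ ℤ.* (ℤ.-1ℤ ℤ.^ n)) 0  ≡⟨ cong (λ z → ℚᵘ.mkℚᵘ z 0) (ℤ.-1*i≡-i (ℤ.-1ℤ ℤ.^ n)) ⟩
    ℚᵘ.- ℚᵘ.mkℚᵘ (ℤ.-1ℤ ℤ.^ n) 0         ≃⟨ ℚᵘ.-‿cong (ℚ.toℚᵘ-fromℚᵘ _) ⟨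
    ℚᵘ.- ℚ.toℚᵘ (sign n)               ≃⟨ ℚ.toℚᵘ-homo‿- (sign n) ⟨
    ℚ.toℚᵘ (ℚ.- sign n)                ∎)
    where open ℚᵘ.≤-Reasoning

-- Evaluation of polynomials as a ring homomorphism

module Evaluation {c ℓ} (R : CommutativeRing c ℓ)
                  (ι : ℚ → CommutativeRing.Carrier R)
                  (ι-hom : RingMorphisms.IsRingHomomorphism ℚ.+-*-rawRing (CommutativeRing.rawRing R) ι)
                  (x : CommutativeRing.Carrier R) where

  open CommutativeRing R
    renaming (refl to ≈-refl; sym to ≈-sym; trans to ≈-trans; reflexive to ≈-reflexive)
  open RingProperties ring using (-0#≈0#; -‿+-comm; -‿distribʳ-*)
  module ι = RingMorphisms.IsRingHomomorphism ι-hom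
  open import Relation.Binary.Reasoning.Setoid setoid
  open NaturalCoefficients commutativeSemiring using (solve; _:+_; _:*_; _:=_; con)

  ev : Polynomial → Carrier
  ev P = evaluate rawRing ι P x

  ev-⊞ : ∀ P Q → ev (P ⊞ Q) ≈ ev P + ev Q
  ev-⊞ []      Q       = ≈-sym (+-identityˡ _)
  ev-⊞ (a ∷ P) []      = ≈-sym (+-identityʳ _)
  ev-⊞ (a ∷ P) (b ∷ Q) = begin
    ι (a ℚ.+ b) + x * ev (P ⊞ Q)      ≈⟨ +-cong (ι.+-homo a b) (*-congˡ (ev-⊞ P Q)) ⟩
    (ι a + ι b) + x * (ev P + ev Q)
      ≈⟨ solve 5 (λ a b x P Q → (a :+ b) :+ x :* (P :+ Q)
                              := (a :+ x :* P) :+ (b :+ x :* Q))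
           ≈-refl (ι a) (ι b) x (ev P) (ev Q) ⟩
    (ι a + x * ev P) + (ι b + x * ev Q) ∎

  ev-scale : ∀ a Q → ev (List.map (a ℚ.*_) Q) ≈ ι a * ev Q
  ev-scale a []      = ≈-sym (zeroʳ (ι a))
  ev-scale a (b ∷ Q) = begin
    ι (a ℚ.* b) + x * ev (List.map (a ℚ.*_) Q)  ≈⟨ +-cong (ι.*-homo a b) (*-congˡ (ev-scale a Q)) ⟩
    ι a * ι b + x * (ι a * ev Q)
      ≈⟨ solve 4 (λ a b x Q → a :* b :+ x :* (a :* Q) := a :* (b :+ x :* Q))
           ≈-refl (ι a) (ι b) x (ev Q) ⟩
    ι a * (ι b + x * ev Q) ∎

  ev-⊠ : ∀ P Q → ev (P ⊠ Q) ≈ ev P * ev Q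
  ev-⊠ []      Q = ≈-sym (zeroˡ _)
  ev-⊠ (a ∷ P) Q = begin
    ev (List.map (a ℚ.*_) Q ⊞ (0ℚ ∷ (P ⊠ Q)))   ≈⟨ ev-⊞ (List.map (a ℚ.*_) Q) _ ⟩
    ev (List.map (a ℚ.*_) Q) + (ι 0ℚ + x * ev (P ⊠ Q))
      ≈⟨ +-cong (ev-scale a Q) (+-cong ι.0#-homo (*-congˡ (ev-⊠ P Q))) ⟩
    ι a * ev Q + (0# + x * (ev P * ev Q))
      ≈⟨ +-congˡ (+-identityˡ _) ⟩
    ι a * ev Q + x * (ev P * ev Q)
      ≈⟨ solve 4 (λ a x P Q → a :* Q :+ x :* (P :* Q) := (a :+ x :* P) :* Q)
           ≈-refl (ι a) x (ev P) (ev Q) ⟩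
    (ι a + x * ev P) * ev Q ∎

  ev-neg : ∀ P → ev (List.map (λ a → ℚ.- a) P) ≈ - ev P
  ev-neg []      = ≈-sym -0#≈0#
  ev-neg (a ∷ P) = begin
    ι (ℚ.- a) + x * ev (List.map (λ a → ℚ.- a) P)
      ≈⟨ +-cong (ι.-‿homo a) (*-congˡ (ev-neg P)) ⟩
    - ι a + x * - ev P    ≈⟨ +-congˡ (-‿distribʳ-* x (ev P)) ⟨
    - ι a + - (x * ev P)  ≈⟨ -‿+-comm (ι a) _ ⟩
    - (ι a + x * ev P)    ∎

  ev-constant : ∀ a → ev (constant a) ≈ ι a
  ev-constant a = ≈-trans (+-congˡ (zeroʳ x)) (+-identityʳ (ι a))

  ev-indeterminate : ev indeterminate ≈ x
  ev-indeterminate = begin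
    ι 0ℚ + x * (ι 1ℚ + x * 0#)  ≈⟨ +-cong ι.0#-homo (*-congˡ (ev-constant 1ℚ)) ⟩
    0# + x * ι 1ℚ               ≈⟨ +-identityˡ _ ⟩
    x * ι 1ℚ                    ≈⟨ *-congˡ ι.1#-homo ⟩
    x * 1#                      ≈⟨ *-identityʳ x ⟩
    x                           ∎

  -- Lists that are equal in `ℚ[q]` may differ in length; where the shorter one ends, the rest of
  -- the longer one has to evaluate to zero.
  ev-zero : ∀ P → (∀ n → coeff P n ≡ 0ℚ) → ev P ≈ 0#
  ev-zero []      P≈0 = ≈-refl
  ev-zero (a ∷ P) P≈0 = begin
    ι a + x * ev P  ≈⟨ +-cong (ι.⟦⟧-cong (P≈0 0)) (*-congˡ (ev-zero P λ n → P≈0 (suc n))) ⟩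
    ι 0ℚ + x * 0#   ≈⟨ +-cong ι.0#-homo (zeroʳ x) ⟩
    0# + 0#         ≈⟨ +-identityˡ 0# ⟩
    0#              ∎

  ev-cong : ∀ P Q → (∀ n → coeff P n ≡ coeff Q n) → ev P ≈ ev Q
  ev-cong []      Q       P≈Q = ≈-sym (ev-zero Q λ n → sym (P≈Q n))
  ev-cong (a ∷ P) []      P≈Q = ev-zero (a ∷ P) P≈Q
  ev-cong (a ∷ P) (b ∷ Q) P≈Q =
    +-cong (ι.⟦⟧-cong (P≈Q 0)) (*-congˡ (ev-cong P Q λ n → P≈Q (suc n)))

  ev-isRingHomomorphism : RingMorphisms.IsRingHomomorphism ℚ[q] rawRing ev
  ev-isRingHomomorphism = record
    { isSemiringHomomorphism = record
      { isNearSemiringHomomorphism = record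
        { +-isMonoidHomomorphism = record
          { isMagmaHomomorphism = record
            { isRelHomomorphism = record { cong = λ {P} {Q} → ev-cong P Q }
            ; homo              = ev-⊞
            }
          ; ε-homo = ≈-refl
          }
        ; *-homo = ev-⊠
        }
      ; 1#-homo = ≈-trans (ev-constant 1ℚ) ι.1#-homo
      }
    ; -‿homo = ev-neg
    }

-- Compatibility of the power series operations with ring homomorphisms

module Transport {c₁ ℓ₁ c₂ ℓ₂} (A : RawRing c₁ ℓ₁) (R : CommutativeRing c₂ ℓ₂)
                 {ιA : ℚ → RawRing.Carrier A} {ιR : ℚ → CommutativeRing.Carrier R}
                 {φ : RawRing.Carrier A → CommutativeRing.Carrier R}
                 (φ-hom : RingMorphisms.IsRingHomomorphism A (CommutativeRing.rawRing R) φ)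
                 (φ-ι : ∀ a → CommutativeRing._≈_ R (φ (ιA a)) (ιR a)) where

  open CommutativeRing R hiding (refl; sym; trans)
  open CommutativeRing R using () renaming (refl to ≈-refl; sym to ≈-sym; trans to ≈-trans)
  private
    module A = PowerSeries A ιA
    module R = PowerSeries rawRing ιR
    module φ = RingMorphisms.IsRingHomomorphism φ-hom
    module SA {p} = RawRing (A.seriesRing p)
    module SR {p} = RawRing (R.seriesRing p)
    module A^ {p} = RawSemiringOps (SA.rawSemiring {p})
    module R^ {p} = RawSemiringOps (SR.rawSemiring {p})

  infix 4 _⇝_

  -- A relation preserved by each operation in turn. Only the homomorphism property of `φ` enters,
  -- so `A` can be a raw ring such as `ℚ[q]` and no ring laws for coefficient lists are required.
  _⇝_ : ∀ {p} → A.Series p → R.Series p → Set ℓ₂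
  f ⇝ g = ∀ α → φ (f α) ≈ g α

  φ-if : ∀ b → φ (if b then RawRing.1# A else RawRing.0# A) ≈ (if b then 1# else 0#)
  φ-if true  = φ.1#-homo
  φ-if false = φ.0#-homo

  φ-∑-map : ∀ {X : Set} {F : X → RawRing.Carrier A} {G : X → Carrier} →
            (∀ x → φ (F x) ≈ G x) → ∀ xs → φ (A.∑ (List.map F xs)) ≈ R.∑ (List.map G xs)
  φ-∑-map F⇝G []       = φ.0#-homo
  φ-∑-map F⇝G (x ∷ xs) = ≈-trans (φ.+-homo _ _) (+-cong (F⇝G x) (φ-∑-map F⇝G xs))

  φ-∑-applyUpTo : ∀ {F : ℕ → RawRing.Carrier A} {G : ℕ → Carrier} →
                  (∀ k → φ (F k) ≈ G k) → ∀ n → φ (A.∑ (applyUpTo F n)) ≈ R.∑ (applyUpTo G n)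
  φ-∑-applyUpTo F⇝G zero    = φ.0#-homo
  φ-∑-applyUpTo F⇝G (suc n) =
    ≈-trans (φ.+-homo _ _) (+-cong (F⇝G 0) (φ-∑-applyUpTo (λ k → F⇝G (suc k)) n))

  module _ {p : ℕ} where

    ⇝-monomial : ∀ (β : Vec ℕ p) → A.monomial β ⇝ R.monomial β
    ⇝-monomial β α = φ-if _

    ⇝-+ : ∀ {f f′ : A.Series p} {g g′} → f ⇝ g → f′ ⇝ g′ → f SA.+ f′ ⇝ g SR.+ g′
    ⇝-+ f⇝g f′⇝g′ α = ≈-trans (φ.+-homo _ _) (+-cong (f⇝g α) (f′⇝g′ α))

    ⇝-neg : ∀ {f : A.Series p} {g} → f ⇝ g → SA.- f ⇝ SR.- g
    ⇝-neg f⇝g α = ≈-trans (φ.-‿homo _) (-‿cong (f⇝g α))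

    ⇝-* : ∀ {f f′ : A.Series p} {g g′} → f ⇝ g → f′ ⇝ g′ → f SA.* f′ ⇝ g SR.* g′
    ⇝-* f⇝g f′⇝g′ α =
      φ-∑-map (λ β → ≈-trans (φ.*-homo _ _) (*-cong (f⇝g β) (f′⇝g′ _))) (below α)

    ⇝-1 : SA.1# {p} ⇝ SR.1#
    ⇝-1 = ⇝-monomial (replicate p 0)

    ⇝-^ : ∀ {f : A.Series p} {g} → f ⇝ g → ∀ n → f A^.^ n ⇝ g R^.^ n
    ⇝-^ f⇝g zero    = ⇝-1
    ⇝-^ f⇝g (suc n) = ⇝-* f⇝g (⇝-^ f⇝g n)

    ⇝-exp : ∀ {f : A.Series p} {g} → f ⇝ g → A.exp f ⇝ R.exp g
    ⇝-exp f⇝g α = φ-∑-applyUpTo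
      (λ k → ≈-trans (φ.*-homo _ _) (*-cong (φ-ι (invFactorial k)) (⇝-^ f⇝g k α))) (suc (Vec.sum α))

    ⇝-log : ∀ {f : A.Series p} {g} → f ⇝ g → A.log f ⇝ R.log g
    ⇝-log f⇝g α = φ-∑-applyUpTo
      (λ k → ≈-trans (φ.*-homo _ _)
               (*-cong (φ-ι ((ℤ.-1ℤ ℤ.^ k) ℚ./ suc k)) (⇝-^ (⇝-+ f⇝g (⇝-neg ⇝-1)) (suc k) α))) (Vec.sum α)

    ⇝-^ˢ : ∀ {f : A.Series p} {g} → f ⇝ g → ∀ {a b} → φ a ≈ b → f A.^ˢ a ⇝ g R.^ˢ b
    ⇝-^ˢ f⇝g a⇝b =
      ⇝-exp λ α → ≈-trans (φ.*-homo _ _) (*-cong a⇝b (⇝-log f⇝g α))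

    ⇝-∑ : ∀ {X : Set} {F : X → A.Series p} {G : X → R.Series p} → (∀ x → F x ⇝ G x) → ∀ xs →
          foldr SA._+_ SA.0# (List.map F xs) ⇝ foldr SR._+_ SR.0# (List.map G xs)
    ⇝-∑ F⇝G []       = λ α → φ.0#-homo
    ⇝-∑ F⇝G (x ∷ xs) = ⇝-+ (F⇝G x) (⇝-∑ F⇝G xs)

    ⇝-∏ : ∀ {X : Set} {F : X → A.Series p} {G : X → R.Series p} → (∀ x → F x ⇝ G x) → ∀ xs →
          foldr SA._*_ SA.1# (List.map F xs) ⇝ foldr SR._*_ SR.1# (List.map G xs)
    ⇝-∏ F⇝G []       = ⇝-1
    ⇝-∏ F⇝G (x ∷ xs) = ⇝-* (F⇝G x) (⇝-∏ F⇝G xs)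

    ⇝-B : (H : Graph p) → A.B H ⇝ R.B H
    ⇝-B H = ⇝-∑ (λ I → ⇝-∏ (λ i → ⇝-+ (⇝-exp (⇝-monomial (replicate p 0 [ i ]≔ 1))) (⇝-neg ⇝-1))
                            (List.filter (_∈? I) (List.allFin p)))
                (Ind H)

    ⇝-egf : ∀ {a : Vec ℕ p → RawRing.Carrier A} {b} → (∀ l → φ (a l) ≈ b l) → A.egf a ⇝ R.egf b
    ⇝-egf a⇝b l = ≈-trans (φ.*-homo _ _) (*-cong (a⇝b l) (φ-ι _))

-- Polynomials are determined by their values at natural numbers

module PolynomialIdentity where

  open Rational

  open +-*-Solver using (solve; _:+_; _:*_; :-_; _:=_; con)
  open ≡-Reasoning

  -- The values at m of all nonempty suffixes of P, which are the coefficients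
  -- of the quotient of a ∷ P by q - m.
  quotient : ℚ → Polynomial → Polynomial
  quotient m []      = []
  quotient m (a ∷ P) = evalℚ (a ∷ P) m ∷ quotient m P

  quotient-correct : ∀ m a P x →
    evalℚ (a ∷ P) x ≡ evalℚ (a ∷ P) m ℚ.+ (x ℚ.- m) ℚ.* evalℚ (quotient m P) x
  quotient-correct m a []      x =
    solve 3 (λ a m x → a :+ x :* con 0ℚ := (a :+ m :* con 0ℚ) :+ (x :+ :- m) :* con 0ℚ) refl a m x
  quotient-correct m a (b ∷ P) x = trans
    (cong (λ z → a ℚ.+ x ℚ.* z) (quotient-correct m b P x))
    (solve 5 (λ a x m Pm Q → a :+ x :* (Pm :+ (x :+ :- m) :* Q)
                          := (a :+ m :* Pm) :+ (x :+ :- m) :* (Pm :+ x :* Q))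
       refl a x m (evalℚ (b ∷ P) m) (evalℚ (quotient m P) x))

  length-quotient : ∀ m P → List.length (quotient m P) ≡ List.length P
  length-quotient m []      = refl
  length-quotient m (a ∷ P) = cong suc (length-quotient m P)

  -- Horner's scheme read backwards: each coefficient is the value of its suffix minus m times the
  -- value of the next one, so vanishing suffix values force vanishing coefficients.
  quotient-zero : ∀ m a P → evalℚ (a ∷ P) m ≡ 0ℚ → (∀ n → coeff (quotient m P) n ≡ 0ℚ) →
                  ∀ n → coeff (a ∷ P) n ≡ 0ℚ
  quotient-zero m a P       Pm≡0 Q≡0 zero    = begin
    a                    ≡⟨ solve 2 (λ a m → a := a :+ m :* con 0ℚ) refl a m ⟩
    a ℚ.+ m ℚ.* 0ℚ       ≡⟨ cong (λ z → a ℚ.+ m ℚ.* z) (value P Q≡0) ⟨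
    a ℚ.+ m ℚ.* evalℚ P m ≡⟨ Pm≡0 ⟩
    0ℚ                   ∎
    where
    value : ∀ P → (∀ n → coeff (quotient m P) n ≡ 0ℚ) → evalℚ P m ≡ 0ℚ
    value []      _   = refl
    value (b ∷ P) Q≡0 = Q≡0 0
  quotient-zero m a []      Pm≡0 Q≡0 (suc n) = refl
  quotient-zero m a (b ∷ P) Pm≡0 Q≡0 (suc n) = quotient-zero m b P (Q≡0 0) (λ n → Q≡0 (suc n)) n

  -- Dividing out the zero at m keeps the zeros at m + 1, m + 2, ..., since there the factor q - m
  -- takes the nonzero values 1, 2, .... The length `d` is the induction measure, because the
  -- quotient is not a sublist of P.
  vanishing : ∀ d P → List.length P ≡ d → ∀ m → (∀ j → evalℚ P (natℚ (m ℕ.+ j)) ≡ 0ℚ) →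
              ∀ n → coeff P n ≡ 0ℚ
  vanishing d       []      len m P≡0 n = refl
  vanishing (suc d) (a ∷ P) len m P≡0 = quotient-zero (natℚ m) a P Pm≡0
    (vanishing d (quotient (natℚ m) P)
      (trans (length-quotient (natℚ m) P) (ℕ.suc-injective len)) (suc m) Q≡0)
    where
    Pm≡0 : evalℚ (a ∷ P) (natℚ m) ≡ 0ℚ
    Pm≡0 = subst (λ k → evalℚ (a ∷ P) (natℚ k) ≡ 0ℚ) (ℕ.+-identityʳ m) (P≡0 0)

    Q≡0 : ∀ j → evalℚ (quotient (natℚ m) P) (natℚ (suc m ℕ.+ j)) ≡ 0ℚ
    Q≡0 j = *-cancelˡ-0 (natℚ-suc≢0 j) (begin
      natℚ (suc j) ℚ.* Q k
        ≡⟨ solve 4 (λ j m a Q → (con 1ℚ :+ j) :* Q := con 0ℚ :+ (con 1ℚ :+ (m :+ j) :+ :- m) :* Q)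
             refl (natℚ j) (natℚ m) a (Q k) ⟩
      0ℚ ℚ.+ (1ℚ ℚ.+ (natℚ m ℚ.+ natℚ j) ℚ.- natℚ m) ℚ.* Q k
        ≡⟨ cong₂ (λ y z → y ℚ.+ (1ℚ ℚ.+ z ℚ.- natℚ m) ℚ.* Q k) Pm≡0 (Existence.natℚ-+ m j) ⟨
      evalℚ (a ∷ P) (natℚ m) ℚ.+ (natℚ k ℚ.- natℚ m) ℚ.* Q k
        ≡⟨ quotient-correct (natℚ m) a P (natℚ k) ⟨
      evalℚ (a ∷ P) (natℚ k)
        ≡⟨ cong (λ i → evalℚ (a ∷ P) (natℚ i)) (ℕ.+-suc m j) ⟨
      evalℚ (a ∷ P) (natℚ (m ℕ.+ suc j))
        ≡⟨ P≡0 (suc j) ⟩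
      0ℚ ∎)
      where
      k = suc m ℕ.+ j
      Q : ℕ → ℚ
      Q i = evalℚ (quotient (natℚ m) P) (natℚ i)

  coeff-⊞ : ∀ P Q n → coeff (P ⊞ Q) n ≡ coeff P n ℚ.+ coeff Q n
  coeff-⊞ []      Q       n       = sym (ℚ.+-identityˡ _)
  coeff-⊞ (a ∷ P) []      n       = sym (ℚ.+-identityʳ _)
  coeff-⊞ (a ∷ P) (b ∷ Q) zero    = refl
  coeff-⊞ (a ∷ P) (b ∷ Q) (suc n) = coeff-⊞ P Q n

  coeff-neg : ∀ P n → coeff (List.map (λ a → ℚ.- a) P) n ≡ ℚ.- coeff P n
  coeff-neg []      n       = refl
  coeff-neg (a ∷ P) zero    = refl
  coeff-neg (a ∷ P) (suc n) = coeff-neg P n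

  evalℚ-isRingHomomorphism : ∀ x → RingMorphisms.IsRingHomomorphism ℚ[q] ℚ.+-*-rawRing (λ P → evalℚ P x)
  evalℚ-isRingHomomorphism = Evaluation.ev-isRingHomomorphism ℚ.+-*-commutativeRing id
    (Identity.isRingHomomorphism ℚ.+-*-rawRing refl)

  polynomial-identity : ∀ P Q → (∀ k → evalℚ P (natℚ k) ≡ evalℚ Q (natℚ k)) →
                        ∀ n → coeff P n ≡ coeff Q n
  polynomial-identity P Q P≡Q n = x∙y⁻¹≈ε⇒x≈y (coeff P n) (coeff Q n) (begin
    coeff P n ℚ.- coeff Q n  ≡⟨ cong (coeff P n ℚ.+_) (coeff-neg Q n) ⟨
    coeff P n ℚ.+ coeff -Q n ≡⟨ coeff-⊞ P -Q n ⟨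
    coeff (P ⊞ -Q) n         ≡⟨ vanishing _ (P ⊞ -Q) refl 0 difference n ⟩
    0ℚ                       ∎)
    where
    open GroupProperties ℚ.+-0-group using (x∙y⁻¹≈ε⇒x≈y)
    -Q : Polynomial
    -Q = List.map (λ a → ℚ.- a) Q
    difference : ∀ k → evalℚ (P ⊞ -Q) (natℚ k) ≡ 0ℚ
    difference k = begin
      evalℚ (P ⊞ -Q) (natℚ k)                    ≡⟨ eval.+-homo P -Q ⟩
      evalℚ P (natℚ k) ℚ.+ evalℚ -Q (natℚ k)     ≡⟨ cong₂ ℚ._+_ (P≡Q k) (eval.-‿homo Q) ⟩
      evalℚ Q (natℚ k) ℚ.- evalℚ Q (natℚ k)      ≡⟨ ℚ.+-inverseʳ (evalℚ Q (natℚ k)) ⟩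
      0ℚ                                         ∎
      where module eval = RingMorphisms.IsRingHomomorphism (evalℚ-isRingHomomorphism (natℚ k))

-- The product of power series and its derivations

module ℚ⟦x⟧ = PowerSeries ℚ.+-*-rawRing id

module Convolution where

  open ℚ⟦x⟧ using (Series; ∑; monomial)
  open +-*-Solver using (solve; _:+_; _:*_; :-_; _:=_; con)
  open ≡-Reasoning

  at : ∀ {p} → ℕ → Series (suc p) → Series p
  at n f α = f (n ∷ α)

  shift : ∀ {p} → Series (suc p) → Series (suc p)
  shift f α = f (suc (head α) ∷ tail α)

  infixr 8 _·_
  infixl 7 _⊛_
  infixl 6 _⊕_

  -- Multiplication by recursion on the exponent of x₁, from f = at 0 f + x₁ · shift f.
  _⊛_ : ∀ {p} → Series p → Series p → Series p
  (f ⊛ g) []          = f [] ℚ.* g []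
  (f ⊛ g) (zero ∷ α)  = (at 0 f ⊛ at 0 g) α
  (f ⊛ g) (suc n ∷ α) = (at 0 f ⊛ at (suc n) g) α ℚ.+ (shift f ⊛ g) (n ∷ α)

  _·_ : ∀ {p} → ℚ → Series p → Series p
  (a · f) α = a ℚ.* f α

  _⊕_ : ∀ {p} → Series p → Series p → Series p
  (f ⊕ g) α = f α ℚ.+ g α

  one : ∀ {p} → Series p
  one = monomial (replicate _ 0)

  -- The Euler derivation acts diagonally on coefficients, so it respects equality modulo degree N,
  -- whereas ∂/∂xᵢ would lose one degree.
  θ : ∀ {p} → Fin p → Series p → Series p
  θ i f α = natℚ (lookup α i) ℚ.* f α

  -- A coefficient of a product involves no coefficient of larger total degree in either factor. The
  -- bounded form is what makes multiplication well defined modulo degree N.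
  ⊛-cong-≤ : ∀ {p} {f f′ g g′ : Series p} α →
             (∀ β → Vec.sum β ℕ.≤ Vec.sum α → f β ≡ f′ β) →
             (∀ β → Vec.sum β ℕ.≤ Vec.sum α → g β ≡ g′ β) →
             (f ⊛ g) α ≡ (f′ ⊛ g′) α
  ⊛-cong-≤ []          f≡ g≡ = cong₂ ℚ._*_ (f≡ [] ℕ.≤-refl) (g≡ [] ℕ.≤-refl)
  ⊛-cong-≤ (zero ∷ α)  f≡ g≡ = ⊛-cong-≤ α (λ β → f≡ (0 ∷ β)) (λ β → g≡ (0 ∷ β))
  ⊛-cong-≤ (suc n ∷ α) f≡ g≡ = cong₂ ℚ._+_
    (⊛-cong-≤ α (λ β β≤α → f≡ (0 ∷ β) (ℕ.m≤n⇒m≤o+n (suc n) β≤α))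
                (λ β β≤α → g≡ (suc n ∷ β) (ℕ.+-monoʳ-≤ (suc n) β≤α)))
    (⊛-cong-≤ (n ∷ α) (λ { (m ∷ β) β≤α → f≡ (suc m ∷ β) (ℕ.s≤s β≤α) })
                      (λ β β≤α → g≡ β (ℕ.m≤n⇒m≤1+n β≤α)))

  ⊛-cong : ∀ {p} {f f′ g g′ : Series p} → (∀ α → f α ≡ f′ α) → (∀ α → g α ≡ g′ α) →
           ∀ α → (f ⊛ g) α ≡ (f′ ⊛ g′) α
  ⊛-cong f≡ g≡ α = ⊛-cong-≤ α (λ β _ → f≡ β) (λ β _ → g≡ β)

  -- The mirror image of the defining recursion, with x₁ extracted from the second factor;
  -- commutativity follows by comparing the two.
  ⊛-suc : ∀ {p} (f g : Series (suc p)) n α →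
          (f ⊛ g) (suc n ∷ α) ≡ (f ⊛ shift g) (n ∷ α) ℚ.+ (at (suc n) f ⊛ at 0 g) α
  ⊛-suc f g zero    α = refl
  ⊛-suc f g (suc n) α = trans
    (cong ((at 0 f ⊛ at (suc (suc n)) g) α ℚ.+_) (⊛-suc (shift f) g n α))
    (sym (ℚ.+-assoc ((at 0 f ⊛ at (suc (suc n)) g) α) ((shift f ⊛ shift g) (n ∷ α)) _))

  ⊛-comm : ∀ {p} (f g : Series p) α → (f ⊛ g) α ≡ (g ⊛ f) α
  ⊛-comm f g []          = ℚ.*-comm (f []) (g [])
  ⊛-comm f g (zero ∷ α)  = ⊛-comm (at 0 f) (at 0 g) α
  ⊛-comm f g (suc n ∷ α) = begin
    (at 0 f ⊛ at (suc n) g) α ℚ.+ (shift f ⊛ g) (n ∷ α)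
      ≡⟨ cong₂ ℚ._+_ (⊛-comm (at 0 f) (at (suc n) g) α) (⊛-comm (shift f) g (n ∷ α)) ⟩
    (at (suc n) g ⊛ at 0 f) α ℚ.+ (g ⊛ shift f) (n ∷ α)  ≡⟨ ℚ.+-comm _ ((g ⊛ shift f) (n ∷ α)) ⟩
    (g ⊛ shift f) (n ∷ α) ℚ.+ (at (suc n) g ⊛ at 0 f) α  ≡⟨ ⊛-suc g f n α ⟨
    (g ⊛ f) (suc n ∷ α) ∎

  ⊛-distribʳ : ∀ {p} (h f g : Series p) α → ((f ⊕ g) ⊛ h) α ≡ (f ⊛ h) α ℚ.+ (g ⊛ h) α
  ⊛-distribʳ h f g []          = ℚ.*-distribʳ-+ (h []) (f []) (g [])
  ⊛-distribʳ h f g (zero ∷ α)  = ⊛-distribʳ (at 0 h) (at 0 f) (at 0 g) α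
  ⊛-distribʳ h f g (suc n ∷ α) = trans
    (cong₂ ℚ._+_ (⊛-distribʳ (at (suc n) h) (at 0 f) (at 0 g) α)
                 (⊛-distribʳ h (shift f) (shift g) (n ∷ α)))
    (solve 4 (λ a b c d → (a :+ b) :+ (c :+ d) := (a :+ c) :+ (b :+ d)) refl
       ((at 0 f ⊛ at (suc n) h) α) ((at 0 g ⊛ at (suc n) h) α)
       ((shift f ⊛ h) (n ∷ α)) ((shift g ⊛ h) (n ∷ α)))

  ⊛-distribˡ : ∀ {p} (h f g : Series p) α → (h ⊛ (f ⊕ g)) α ≡ (h ⊛ f) α ℚ.+ (h ⊛ g) α
  ⊛-distribˡ h f g α = begin
    (h ⊛ (f ⊕ g)) α            ≡⟨ ⊛-comm h (f ⊕ g) α ⟩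
    ((f ⊕ g) ⊛ h) α            ≡⟨ ⊛-distribʳ h f g α ⟩
    (f ⊛ h) α ℚ.+ (g ⊛ h) α    ≡⟨ cong₂ ℚ._+_ (⊛-comm f h α) (⊛-comm g h α) ⟩
    (h ⊛ f) α ℚ.+ (h ⊛ g) α    ∎

  ·-⊛ : ∀ {p} a (f g : Series p) α → (a · f ⊛ g) α ≡ a ℚ.* (f ⊛ g) α
  ·-⊛ a f g []          = ℚ.*-assoc a (f []) (g [])
  ·-⊛ a f g (zero ∷ α)  = ·-⊛ a (at 0 f) (at 0 g) α
  ·-⊛ a f g (suc n ∷ α) = trans
    (cong₂ ℚ._+_ (·-⊛ a (at 0 f) (at (suc n) g) α) (·-⊛ a (shift f) g (n ∷ α)))
    (sym (ℚ.*-distribˡ-+ a _ _))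

  ⊛-· : ∀ {p} a (f g : Series p) α → (f ⊛ a · g) α ≡ a ℚ.* (f ⊛ g) α
  ⊛-· a f g α = begin
    (f ⊛ a · g) α       ≡⟨ ⊛-comm f (a · g) α ⟩
    (a · g ⊛ f) α       ≡⟨ ·-⊛ a g f α ⟩
    a ℚ.* (g ⊛ f) α     ≡⟨ cong (a ℚ.*_) (⊛-comm g f α) ⟩
    a ℚ.* (f ⊛ g) α     ∎

  ⊛-zeroˡ : ∀ {p} (g : Series p) α → ((λ _ → 0ℚ) ⊛ g) α ≡ 0ℚ
  ⊛-zeroˡ g []          = ℚ.*-zeroˡ (g [])
  ⊛-zeroˡ g (zero ∷ α)  = ⊛-zeroˡ (at 0 g) α
  ⊛-zeroˡ g (suc n ∷ α) = cong₂ ℚ._+_ (⊛-zeroˡ (at (suc n) g) α) (⊛-zeroˡ g (n ∷ α))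

  ⊛-zeroʳ : ∀ {p} (g : Series p) α → (g ⊛ (λ _ → 0ℚ)) α ≡ 0ℚ
  ⊛-zeroʳ g α = trans (⊛-comm g _ α) (⊛-zeroˡ g α)

  ⊛-identityˡ : ∀ {p} (g : Series p) α → (one ⊛ g) α ≡ g α
  ⊛-identityˡ g []          = ℚ.*-identityˡ (g [])
  ⊛-identityˡ g (zero ∷ α)  = ⊛-identityˡ (at 0 g) α
  ⊛-identityˡ g (suc n ∷ α) = begin
    (one ⊛ at (suc n) g) α ℚ.+ ((λ _ → 0ℚ) ⊛ g) (n ∷ α)
      ≡⟨ cong₂ ℚ._+_ (⊛-identityˡ (at (suc n) g) α) (⊛-zeroˡ g (n ∷ α)) ⟩
    g (suc n ∷ α) ℚ.+ 0ℚ  ≡⟨ ℚ.+-identityʳ _ ⟩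
    g (suc n ∷ α)         ∎

  -- Multiplication of a series in x₁, …, xₚ by one not involving x₁.
  _▹_ : ∀ {p} → Series p → Series (suc p) → Series (suc p)
  (a ▹ g) α = (a ⊛ at (head α) g) (tail α)

  mutual

    -- The shift of `f ⊛ g` is `(at 0 f ▹ shift g) ⊕ (shift f ⊛ g)`, so the induction for
    -- associativity meets a factor free of x₁. For such a factor the law reduces to associativity
    -- in one variable fewer, whence the mutual recursion.
    ▹-⊛ : ∀ {p} a (g h : Series (suc p)) α → ((a ▹ g) ⊛ h) α ≡ (a ▹ (g ⊛ h)) α
    ▹-⊛ a g h (zero ∷ α)  = ⊛-assoc a (at 0 g) (at 0 h) α
    ▹-⊛ a g h (suc n ∷ α) = begin
      ((a ⊛ at 0 g) ⊛ at (suc n) h) α ℚ.+ ((a ▹ shift g) ⊛ h) (n ∷ α)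
        ≡⟨ cong₂ ℚ._+_ (⊛-assoc a (at 0 g) (at (suc n) h) α) (▹-⊛ a (shift g) h (n ∷ α)) ⟩
      (a ⊛ (at 0 g ⊛ at (suc n) h)) α ℚ.+ (a ⊛ at n (shift g ⊛ h)) α
        ≡⟨ ⊛-distribˡ a (at 0 g ⊛ at (suc n) h) (at n (shift g ⊛ h)) α ⟨
      (a ⊛ at (suc n) (g ⊛ h)) α ∎

    ⊛-assoc : ∀ {p} (f g h : Series p) α → ((f ⊛ g) ⊛ h) α ≡ (f ⊛ (g ⊛ h)) α
    ⊛-assoc f g h []          = ℚ.*-assoc (f []) (g []) (h [])
    ⊛-assoc f g h (zero ∷ α)  = ⊛-assoc (at 0 f) (at 0 g) (at 0 h) α
    ⊛-assoc f g h (suc n ∷ α) = begin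
      (at 0 (f ⊛ g) ⊛ at (suc n) h) α ℚ.+ (shift (f ⊛ g) ⊛ h) (n ∷ α)
        ≡⟨ cong₂ ℚ._+_ (⊛-assoc (at 0 f) (at 0 g) (at (suc n) h) α)
             (⊛-cong {g = h} (λ { (m ∷ β) → refl }) (λ _ → refl) (n ∷ α)) ⟩
      (at 0 f ⊛ (at 0 g ⊛ at (suc n) h)) α ℚ.+ (((at 0 f ▹ shift g) ⊕ (shift f ⊛ g)) ⊛ h) (n ∷ α)
        ≡⟨ cong ((at 0 f ⊛ (at 0 g ⊛ at (suc n) h)) α ℚ.+_)
             (⊛-distribʳ h (at 0 f ▹ shift g) (shift f ⊛ g) (n ∷ α)) ⟩
      (at 0 f ⊛ (at 0 g ⊛ at (suc n) h)) α ℚ.+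
        (((at 0 f ▹ shift g) ⊛ h) (n ∷ α) ℚ.+ ((shift f ⊛ g) ⊛ h) (n ∷ α))
        ≡⟨ cong₂ (λ y z → (at 0 f ⊛ (at 0 g ⊛ at (suc n) h)) α ℚ.+ (y ℚ.+ z))
             (▹-⊛ (at 0 f) (shift g) h (n ∷ α)) (⊛-assoc (shift f) g h (n ∷ α)) ⟩
      (at 0 f ⊛ (at 0 g ⊛ at (suc n) h)) α ℚ.+
        ((at 0 f ⊛ at n (shift g ⊛ h)) α ℚ.+ (shift f ⊛ (g ⊛ h)) (n ∷ α))
        ≡⟨ ℚ.+-assoc ((at 0 f ⊛ (at 0 g ⊛ at (suc n) h)) α) _ _ ⟨
      (at 0 f ⊛ (at 0 g ⊛ at (suc n) h)) α ℚ.+ (at 0 f ⊛ at n (shift g ⊛ h)) α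
        ℚ.+ (shift f ⊛ (g ⊛ h)) (n ∷ α)
        ≡⟨ cong (ℚ._+ (shift f ⊛ (g ⊛ h)) (n ∷ α))
             (⊛-distribˡ (at 0 f) (at 0 g ⊛ at (suc n) h) (at n (shift g ⊛ h)) α) ⟨
      (at 0 f ⊛ at (suc n) (g ⊛ h)) α ℚ.+ (shift f ⊛ (g ⊛ h)) (n ∷ α) ∎

  θ-⊛ : ∀ {p} i (f g : Series p) α → θ i (f ⊛ g) α ≡ (θ i f ⊛ g) α ℚ.+ (f ⊛ θ i g) α
  θ-⊛ zero f g (zero ∷ α) = begin
    0ℚ ℚ.* (at 0 f ⊛ at 0 g) α
      ≡⟨ solve 1 (λ z → con 0ℚ :* z := con 0ℚ :* z :+ con 0ℚ :* z) refl ((at 0 f ⊛ at 0 g) α) ⟩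
    0ℚ ℚ.* (at 0 f ⊛ at 0 g) α ℚ.+ 0ℚ ℚ.* (at 0 f ⊛ at 0 g) α
      ≡⟨ cong₂ ℚ._+_ (·-⊛ 0ℚ (at 0 f) (at 0 g) α) (⊛-· 0ℚ (at 0 f) (at 0 g) α) ⟨
    (0ℚ · at 0 f ⊛ at 0 g) α ℚ.+ (at 0 f ⊛ 0ℚ · at 0 g) α ∎
  θ-⊛ zero f g (suc n ∷ α) = begin
    (1ℚ ℚ.+ natℚ n) ℚ.* (u ℚ.+ v)
      ≡⟨ solve 3 (λ n u v → (con 1ℚ :+ n) :* (u :+ v)
                         := con 0ℚ :* u :+ (v :+ n :* v) :+ (con 1ℚ :+ n) :* u)
           refl (natℚ n) u v ⟩
    0ℚ ℚ.* u ℚ.+ (v ℚ.+ natℚ n ℚ.* v) ℚ.+ natℚ (suc n) ℚ.* u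
      ≡⟨ cong (λ z → 0ℚ ℚ.* u ℚ.+ (v ℚ.+ z) ℚ.+ natℚ (suc n) ℚ.* u) (θ-⊛ zero (shift f) g (n ∷ α)) ⟩
    0ℚ ℚ.* u ℚ.+ (v ℚ.+ (s ℚ.+ t)) ℚ.+ natℚ (suc n) ℚ.* u
      ≡⟨ solve 5 (λ a b v s t → a :+ (v :+ (s :+ t)) :+ b := (a :+ (v :+ s)) :+ (b :+ t))
           refl (0ℚ ℚ.* u) (natℚ (suc n) ℚ.* u) v s t ⟩
    (0ℚ ℚ.* u ℚ.+ (v ℚ.+ s)) ℚ.+ (natℚ (suc n) ℚ.* u ℚ.+ t)
      ≡⟨ cong₂ (λ y z → (y ℚ.+ (v ℚ.+ s)) ℚ.+ (z ℚ.+ t))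
           (·-⊛ 0ℚ (at 0 f) (at (suc n) g) α) (⊛-· (natℚ (suc n)) (at 0 f) (at (suc n) g) α) ⟨
    ((at 0 (θ zero f) ⊛ at (suc n) g) α ℚ.+ (v ℚ.+ s)) ℚ.+ (f ⊛ θ zero g) (suc n ∷ α)
      ≡⟨ cong (λ z → ((at 0 (θ zero f) ⊛ at (suc n) g) α ℚ.+ z) ℚ.+ (f ⊛ θ zero g) (suc n ∷ α)) shift-θ ⟨
    (θ zero f ⊛ g) (suc n ∷ α) ℚ.+ (f ⊛ θ zero g) (suc n ∷ α) ∎
    where
    u = (at 0 f ⊛ at (suc n) g) α
    v = (shift f ⊛ g) (n ∷ α)
    s = (θ zero (shift f) ⊛ g) (n ∷ α)
    t = (shift f ⊛ θ zero g) (n ∷ α)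
    -- θ in the first variable does not commute with `shift`: the weight m + 1 splits as 1 + m, and
    -- the part 1 produces the extra summand `v`.
    shift-θ : (shift (θ zero f) ⊛ g) (n ∷ α) ≡ v ℚ.+ s
    shift-θ = trans
      (⊛-cong {f′ = shift f ⊕ θ zero (shift f)} {g = g}
        (λ { (m ∷ β) → solve 2 (λ m z → (con 1ℚ :+ m) :* z := z :+ m :* z) refl (natℚ m) (f (suc m ∷ β)) })
        (λ _ → refl) (n ∷ α))
      (⊛-distribʳ g (shift f) (θ zero (shift f)) (n ∷ α))
  θ-⊛ (suc j) f g (zero ∷ α)  = θ-⊛ j (at 0 f) (at 0 g) α
  θ-⊛ (suc j) f g (suc n ∷ α) = begin
    a ℚ.* (u ℚ.+ v)          ≡⟨ ℚ.*-distribˡ-+ a u v ⟩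
    a ℚ.* u ℚ.+ a ℚ.* v
      ≡⟨ cong₂ ℚ._+_ (θ-⊛ j (at 0 f) (at (suc n) g) α) (θ-⊛ (suc j) (shift f) g (n ∷ α)) ⟩
    (u₁ ℚ.+ u₂) ℚ.+ ((θ (suc j) (shift f) ⊛ g) (n ∷ α) ℚ.+ v₂)
      ≡⟨ solve 4 (λ u₁ u₂ v₁ v₂ → (u₁ :+ u₂) :+ (v₁ :+ v₂) := (u₁ :+ v₁) :+ (u₂ :+ v₂))
           refl u₁ u₂ ((θ (suc j) (shift f) ⊛ g) (n ∷ α)) v₂ ⟩
    (u₁ ℚ.+ (θ (suc j) (shift f) ⊛ g) (n ∷ α)) ℚ.+ (u₂ ℚ.+ v₂)
      ≡⟨ cong (λ z → (u₁ ℚ.+ z) ℚ.+ (u₂ ℚ.+ v₂))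
           (⊛-cong {g = g} (λ { (m ∷ β) → refl }) (λ _ → refl) (n ∷ α)) ⟩
    (θ (suc j) f ⊛ g) (suc n ∷ α) ℚ.+ (f ⊛ θ (suc j) g) (suc n ∷ α) ∎
    where
    a = natℚ (lookup α j)
    u = (at 0 f ⊛ at (suc n) g) α
    v = (shift f ⊛ g) (n ∷ α)
    u₁ = (θ j (at 0 f) ⊛ at (suc n) g) α
    u₂ = (at 0 f ⊛ θ j (at (suc n) g)) α
    v₂ = (shift f ⊛ θ (suc j) g) (n ∷ α)

  -- A factor without constant term uses up at least one degree, so the other factor contributes
  -- only coefficients of strictly smaller degree. Both the order of powers and the uniqueness of
  -- solutions rest on this.
  ⊛-local : ∀ {p} (u g g′ : Series p) → u (replicate p 0) ≡ 0ℚ → ∀ α →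
            (∀ β → Vec.sum β ℕ.< Vec.sum α → g β ≡ g′ β) → (u ⊛ g) α ≡ (u ⊛ g′) α
  ⊛-local u g g′ u0 []          g≡g′ rewrite u0 = trans (ℚ.*-zeroˡ (g [])) (sym (ℚ.*-zeroˡ (g′ [])))
  ⊛-local u g g′ u0 (zero ∷ α)  g≡g′ = ⊛-local (at 0 u) (at 0 g) (at 0 g′) u0 α (λ β → g≡g′ (0 ∷ β))
  ⊛-local u g g′ u0 (suc n ∷ α) g≡g′ = cong₂ ℚ._+_
    (⊛-local (at 0 u) (at (suc n) g) (at (suc n) g′) u0 α λ β β<α → g≡g′ (suc n ∷ β) (ℕ.+-monoʳ-< (suc n) β<α))
    (⊛-cong-≤ {f = shift u} (n ∷ α) (λ _ _ → refl) λ β β≤α → g≡g′ β (ℕ.s≤s β≤α))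

  ∑-++ : ∀ xs ys → ∑ (xs List.++ ys) ≡ ∑ xs ℚ.+ ∑ ys
  ∑-++ []       ys = sym (ℚ.+-identityˡ _)
  ∑-++ (x ∷ xs) ys = trans (cong (x ℚ.+_) (∑-++ xs ys)) (sym (ℚ.+-assoc x _ _))

  ∑-product : ∀ {p} (F : Vec ℕ (suc p) → ℚ) (h : ℕ → ℕ) m ys →
              ∑ (List.map F (cartesianProductWith _∷_ (applyUpTo h m) ys)) ≡
              ∑ (applyUpTo (λ k → ∑ (List.map (λ β → F (h k ∷ β)) ys)) m)
  ∑-product F h zero    ys = refl
  ∑-product F h (suc m) ys = begin
    ∑ (List.map F (List.map (h 0 ∷_) ys List.++ rest))
      ≡⟨ cong ∑ (List.map-++ F (List.map (h 0 ∷_) ys) rest) ⟩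
    ∑ (List.map F (List.map (h 0 ∷_) ys) List.++ List.map F rest)
      ≡⟨ ∑-++ (List.map F (List.map (h 0 ∷_) ys)) _ ⟩
    ∑ (List.map F (List.map (h 0 ∷_) ys)) ℚ.+ ∑ (List.map F rest)
      ≡⟨ cong₂ (λ xs z → ∑ xs ℚ.+ z) (sym (List.map-∘ ys)) (∑-product F (λ k → h (suc k)) m ys) ⟩
    ∑ (applyUpTo (λ k → ∑ (List.map (λ β → F (h k ∷ β)) ys)) (suc m)) ∎
    where
    rest = cartesianProductWith _∷_ (applyUpTo (λ k → h (suc k)) m) ys

  ∑-applyUpTo-cong : ∀ {F G : ℕ → ℚ} → (∀ k → F k ≡ G k) → ∀ n →
                     ∑ (applyUpTo F n) ≡ ∑ (applyUpTo G n)
  ∑-applyUpTo-cong F≡G zero    = refl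
  ∑-applyUpTo-cong F≡G (suc n) = cong₂ ℚ._+_ (F≡G 0) (∑-applyUpTo-cong (λ k → F≡G (suc k)) n)

  ∑-⊛ : ∀ {p} (f g : Series (suc p)) n α →
        ∑ (applyUpTo (λ k → (at k f ⊛ at (n ∸ k) g) α) (suc n)) ≡ (f ⊛ g) (n ∷ α)
  ∑-⊛ f g zero    α = ℚ.+-identityʳ _
  ∑-⊛ f g (suc n) α = cong ((at 0 f ⊛ at (suc n) g) α ℚ.+_) (∑-⊛ (shift f) g n α)

  -- The bridge from the defining sum to the recursion; the laws of multiplication in `seriesRing`
  -- are obtained through it.
  *≡⊛ : ∀ {p} (f g : Series p) α → RawRing._*_ (ℚ⟦x⟧.seriesRing p) f g α ≡ (f ⊛ g) α
  *≡⊛ f g []      = ℚ.+-identityʳ _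
  *≡⊛ f g (n ∷ α) = begin
    ∑ (List.map _ (cartesianProductWith _∷_ (upTo (suc n)) (below α)))
      ≡⟨ ∑-product _ id (suc n) (below α) ⟩
    ∑ (applyUpTo (λ k → RawRing._*_ (ℚ⟦x⟧.seriesRing _) (at k f) (at (n ∸ k) g) α) (suc n))
      ≡⟨ ∑-applyUpTo-cong (λ k → *≡⊛ (at k f) (at (n ∸ k) g) α) (suc n) ⟩
    ∑ (applyUpTo (λ k → (at k f ⊛ at (n ∸ k) g) α) (suc n))
      ≡⟨ ∑-⊛ f g n α ⟩
    (f ⊛ g) (n ∷ α) ∎

  ∑-applyUpTo-suc : ∀ (F : ℕ → ℚ) n → ∑ (applyUpTo F (suc n)) ≡ ∑ (applyUpTo F n) ℚ.+ F n
  ∑-applyUpTo-suc F zero    = ℚ.+-comm (F 0) 0ℚ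
  ∑-applyUpTo-suc F (suc n) = trans
    (cong (F 0 ℚ.+_) (∑-applyUpTo-suc (λ k → F (suc k)) n))
    (sym (ℚ.+-assoc (F 0) (∑ (applyUpTo (λ k → F (suc k)) n)) (F (suc n))))

  -- Lets the length of the sums defining `exp` and `log`, which varies with the exponent, be
  -- replaced by a common one. With m = 0 it says that a sum of zeros vanishes.
  ∑-applyUpTo-stable : ∀ (F : ℕ → ℚ) m → (∀ k → m ℕ.≤ k → F k ≡ 0ℚ) →
                       ∀ {n} → m ℕ.≤ n → ∑ (applyUpTo F m) ≡ ∑ (applyUpTo F n)
  ∑-applyUpTo-stable F zero    F≡0 {zero}  m≤n = refl
  ∑-applyUpTo-stable F zero    F≡0 {suc n} m≤n = sym (cong₂ ℚ._+_ (F≡0 0 ℕ.z≤n)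
    (sym (∑-applyUpTo-stable (λ k → F (suc k)) 0 (λ k _ → F≡0 (suc k) ℕ.z≤n) {n} ℕ.z≤n)))
  ∑-applyUpTo-stable F (suc m) F≡0 (ℕ.s≤s m≤n) =
    cong (F 0 ℚ.+_) (∑-applyUpTo-stable (λ k → F (suc k)) m (λ k m≤k → F≡0 (suc k) (ℕ.s≤s m≤k)) m≤n)

  sum-replicate-0 : ∀ p → Vec.sum (replicate p 0) ≡ 0
  sum-replicate-0 zero    = refl
  sum-replicate-0 (suc p) = sum-replicate-0 p

  one-0 : ∀ p → one (replicate p 0) ≡ 1ℚ
  one-0 zero    = refl
  one-0 (suc p) = one-0 p

  ⊛-0 : ∀ p (f g : Series p) → (f ⊛ g) (replicate p 0) ≡ f (replicate p 0) ℚ.* g (replicate p 0)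
  ⊛-0 zero    f g = refl
  ⊛-0 (suc p) f g = ⊛-0 p (at 0 f) (at 0 g)

  -- θᵢ multiplies a coefficient by its i-th exponent, which can be cancelled only if it is nonzero;
  -- an index i of this kind is missing only for the constant term.
  positive-entry : ∀ {p} (α : Vec ℕ p) → α ≡ replicate p 0 ⊎ ∃ λ i → ∃ λ m → lookup α i ≡ suc m
  positive-entry []          = inj₁ refl
  positive-entry (suc n ∷ α) = inj₂ (zero , n , refl)
  positive-entry (zero ∷ α) with positive-entry α
  ... | inj₁ α≡0           = inj₁ (cong (0 ∷_) α≡0)
  ... | inj₂ (i , m , αi≡) = inj₂ (suc i , m , αi≡)

-- Exponential, logarithm and powers through differential equations

module Exponential {p : ℕ} where

  open Rational
  open Convolution
  open ℚ⟦x⟧ using (Series; ∑; exp; log; _^ˢ_)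

  private module S = RawRing (ℚ⟦x⟧.seriesRing p)
  open RawSemiringOps S.rawSemiring using (_^_)

  -- Power series modulo terms of degree at least N, so that exp and log are finite sums.
  truncatedRing : ℕ → CommutativeRing _ _
  truncatedRing N = record
    { Carrier = Series p
    ; _≈_     = λ f g → ∀ α → Vec.sum α ℕ.< N → f α ≡ g α
    ; _+_     = S._+_
    ; _*_     = S._*_
    ; -_      = S.-_
    ; 0#      = S.0#
    ; 1#      = S.1#
    ; isCommutativeRing = record
      { isRing = record
        { +-isAbelianGroup = record
          { isGroup = record
            { isMonoid = record
              { isSemigroup = record
                { isMagma = record
                  { isEquivalence = record
                    { refl  = λ α _ → refl
                    ; sym   = λ f≈g α α<N → sym (f≈g α α<N)
                    ; trans = λ f≈g g≈h α α<N → trans (f≈g α α<N) (g≈h α α<N)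
                    }
                  ; ∙-cong = λ f≈f′ g≈g′ α α<N → cong₂ ℚ._+_ (f≈f′ α α<N) (g≈g′ α α<N)
                  }
                ; assoc = λ f g h α _ → ℚ.+-assoc (f α) (g α) (h α)
                }
              ; identity = (λ f α _ → ℚ.+-identityˡ (f α)) , (λ f α _ → ℚ.+-identityʳ (f α))
              }
            ; inverse = (λ f α _ → ℚ.+-inverseˡ (f α)) , (λ f α _ → ℚ.+-inverseʳ (f α))
            ; ⁻¹-cong = λ f≈g α α<N → cong (λ z → ℚ.- z) (f≈g α α<N)
            }
          ; comm = λ f g α _ → ℚ.+-comm (f α) (g α)
          }
        ; *-cong = λ {f} {f′} {g} {g′} f≈f′ g≈g′ α α<N → via (f S.* g) (f′ S.* g′) α
            (*≡⊛ f g) (*≡⊛ f′ g′)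
            (⊛-cong-≤ α (λ β β≤α → f≈f′ β (ℕ.≤-<-trans β≤α α<N))
                        (λ β β≤α → g≈g′ β (ℕ.≤-<-trans β≤α α<N)))
        ; *-assoc = λ f g h α _ → via ((f S.* g) S.* h) (f S.* (g S.* h)) α
            (λ α → trans (*≡⊛ (f S.* g) h α) (⊛-cong {g = h} (*≡⊛ f g) (λ _ → refl) α))
            (λ α → trans (*≡⊛ f (g S.* h) α) (⊛-cong {f = f} (λ _ → refl) (*≡⊛ g h) α))
            (⊛-assoc f g h α)
        ; *-identity = (λ f α _ → trans (*≡⊛ S.1# f α) (⊛-identityˡ f α))
                     , (λ f α _ → trans (*≡⊛ f S.1# α) (trans (⊛-comm f S.1# α) (⊛-identityˡ f α)))
        ; distrib = (λ h f g α _ → via (h S.* (f S.+ g)) ((h S.* f) S.+ (h S.* g)) α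
                      (*≡⊛ h (f S.+ g)) (λ α → cong₂ ℚ._+_ (*≡⊛ h f α) (*≡⊛ h g α))
                      (⊛-distribˡ h f g α))
                  , (λ h f g α _ → via ((f S.+ g) S.* h) ((f S.* h) S.+ (g S.* h)) α
                      (*≡⊛ (f S.+ g) h) (λ α → cong₂ ℚ._+_ (*≡⊛ f h α) (*≡⊛ g h α))
                      (⊛-distribʳ h f g α))
        }
      ; *-comm = λ f g α _ → via (f S.* g) (g S.* f) α (*≡⊛ f g) (*≡⊛ g f) (⊛-comm f g α)
      }
    }
    where
    via : ∀ (f g : Series p) α {f′ g′ : Series p} → (∀ α → f α ≡ f′ α) → (∀ α → g α ≡ g′ α) →
          f′ α ≡ g′ α → f α ≡ g α
    via f g α f≡ g≡ eq = trans (f≡ α) (trans eq (sym (g≡ α)))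

  -- Each factor `u` uses up one degree, by `⊛-local`. This is why only finitely many terms of `exp`
  -- and `log` matter modulo degree N.
  ^-order : ∀ (u : Series p) → u (replicate p 0) ≡ 0ℚ →
            ∀ k α → Vec.sum α ℕ.< k → (u ^ k) α ≡ 0ℚ
  ^-order u u0 (suc k) α (ℕ.s≤s α≤k) = begin
    (u S.* (u ^ k)) α   ≡⟨ *≡⊛ u (u ^ k) α ⟩
    (u ⊛ (u ^ k)) α     ≡⟨ ⊛-local u (u ^ k) S.0# u0 α (λ β β<α → ^-order u u0 k β (ℕ.<-≤-trans β<α α≤k)) ⟩
    (u ⊛ S.0#) α        ≡⟨ ⊛-zeroʳ u α ⟩
    0ℚ                  ∎
    where open ≡-Reasoning

  logTerm : Series p → ℕ → Series p
  logTerm u k = ((ℤ.-1ℤ ℤ.^ k) ℚ./ suc k) · (u ^ suc k)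

  expTerm : Series p → ℕ → Series p
  expTerm h k = invFactorial k · (h ^ k)

  partialSum : (ℕ → Series p) → ℕ → Series p
  partialSum t n α = ∑ (applyUpTo (λ k → t k α) n)

  minusOne : Series p → Series p
  minusOne f = f S.+ (S.- S.1#)

  minusOne-0 : ∀ f → f (replicate p 0) ≡ 1ℚ → minusOne f (replicate p 0) ≡ 0ℚ
  minusOne-0 f f0≡1 = cong₂ ℚ._-_ f0≡1 (one-0 p)

  ·-log-0 : ∀ f a → (a · log f) (replicate p 0) ≡ 0ℚ
  ·-log-0 f a = trans
    (cong (λ n → a ℚ.* partialSum (logTerm (minusOne f)) n (replicate p 0)) (sum-replicate-0 p))
    (ℚ.*-zeroʳ a)

  module _ (N : ℕ) (i : Fin p) where

    open CommutativeRing (truncatedRing N)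
      using (_≈_; setoid; +-cong; +-congˡ; *-cong; *-congˡ; *-congʳ; *-comm; *-assoc;
        *-identityˡ; *-identityʳ; zeroˡ; zeroʳ; +-identityʳ; distribˡ; distribʳ)
      renaming (refl to ≈-refl; sym to ≈-sym; trans to ≈-trans)
    open import Relation.Binary.Reasoning.Setoid setoid

    θ-cong : ∀ {f g} → f ≈ g → θ i f ≈ θ i g
    θ-cong f≈g α α<N = cong (natℚ (lookup α i) ℚ.*_) (f≈g α α<N)

    ·-cong : ∀ a {f g} → f ≈ g → a · f ≈ a · g
    ·-cong a f≈g α α<N = cong (a ℚ.*_) (f≈g α α<N)

    θ-+ : ∀ f g → θ i (f S.+ g) ≈ θ i f S.+ θ i g
    θ-+ f g α _ = ℚ.*-distribˡ-+ (natℚ (lookup α i)) (f α) (g α)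

    θ-neg : ∀ f → θ i (S.- f) ≈ S.- θ i f
    θ-neg f α _ = sym (ℚ.neg-distribʳ-* (natℚ (lookup α i)) (f α))

    θ-· : ∀ a f → θ i (a · f) ≈ a · θ i f
    θ-· a f α _ = solve 3 (λ n a f → n :* (a :* f) := a :* (n :* f)) refl (natℚ (lookup α i)) a (f α)
      where open +-*-Solver

    θ-* : ∀ f g → θ i (f S.* g) ≈ θ i f S.* g S.+ f S.* θ i g
    θ-* f g α _ = trans (cong (natℚ (lookup α i) ℚ.*_) (*≡⊛ f g α))
      (trans (θ-⊛ i f g α) (sym (cong₂ ℚ._+_ (*≡⊛ (θ i f) g α) (*≡⊛ f (θ i g) α))))

    ·-*ˡ : ∀ a f g → a · f S.* g ≈ a · (f S.* g)
    ·-*ˡ a f g α _ = trans (*≡⊛ (a · f) g α)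
      (trans (·-⊛ a f g α) (sym (cong (a ℚ.*_) (*≡⊛ f g α))))

    *-·ʳ : ∀ a f g → f S.* a · g ≈ a · (f S.* g)
    *-·ʳ a f g α _ = trans (*≡⊛ f (a · g) α)
      (trans (⊛-· a f g α) (sym (cong (a ℚ.*_) (*≡⊛ f g α))))

    -- The Leibniz rule for the product of 1 with itself gives x = x + x.
    θ-1 : θ i S.1# ≈ S.0#
    θ-1 α α<N = x≡0
      where
      x = natℚ (lookup α i) ℚ.* S.1# α
      double : x ≡ x ℚ.+ x
      double = (begin
        θ i S.1#                                   ≈⟨ θ-cong (*-identityˡ S.1#) ⟨
        θ i (S.1# S.* S.1#)                        ≈⟨ θ-* S.1# S.1# ⟩
        θ i S.1# S.* S.1# S.+ S.1# S.* θ i S.1#    ≈⟨ +-cong (*-identityʳ (θ i S.1#)) (*-identityˡ (θ i S.1#)) ⟩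
        θ i S.1# S.+ θ i S.1#                      ∎) α α<N
      x≡0 : x ≡ 0ℚ
      x≡0 = trans (solve 1 (λ x → x := (x :+ x) :+ :- x) refl x)
                     (trans (cong (ℚ._- x) (sym double)) (ℚ.+-inverseʳ x))
        where open +-*-Solver

    θ-minusOne : ∀ f → θ i (minusOne f) ≈ θ i f
    θ-minusOne f = begin
      θ i (f S.+ (S.- S.1#))         ≈⟨ θ-+ f (S.- S.1#) ⟩
      θ i f S.+ θ i (S.- S.1#)       ≈⟨ +-congˡ {θ i f} (θ-neg S.1#) ⟩
      θ i f S.+ (S.- θ i S.1#)       ≈⟨ (λ α α<N → cong (λ z → θ i f α ℚ.- z) (θ-1 α α<N)) ⟩
      θ i f S.+ S.0#                 ≈⟨ +-identityʳ _ ⟩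
      θ i f                          ∎

    θ-^ : ∀ f k → θ i (f ^ suc k) ≈ natℚ (suc k) · ((f ^ k) S.* θ i f)
    θ-^ f zero    = begin
      θ i (f S.* S.1#)                   ≈⟨ θ-cong (*-identityʳ f) ⟩
      θ i f                              ≈⟨ *-identityˡ (θ i f) ⟨
      S.1# S.* θ i f                     ≈⟨ (λ α _ → sym (ℚ.*-identityˡ _)) ⟩
      natℚ 1 · (S.1# S.* θ i f)          ∎
    θ-^ f (suc k) = begin
      θ i (f S.* f ^ suc k)
        ≈⟨ θ-* f (f ^ suc k) ⟩
      θ i f S.* f ^ suc k S.+ f S.* θ i (f ^ suc k)
        ≈⟨ +-cong (*-comm (θ i f) (f ^ suc k)) (*-congˡ {f} (θ-^ f k)) ⟩
      f ^ suc k S.* θ i f S.+ f S.* (natℚ (suc k) · ((f ^ k) S.* θ i f))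
        ≈⟨ +-congˡ {f ^ suc k S.* θ i f} (*-·ʳ (natℚ (suc k)) f ((f ^ k) S.* θ i f)) ⟩
      f ^ suc k S.* θ i f S.+ natℚ (suc k) · (f S.* ((f ^ k) S.* θ i f))
        ≈⟨ +-congˡ {f ^ suc k S.* θ i f} (·-cong (natℚ (suc k)) (*-assoc f (f ^ k) (θ i f))) ⟨
      f ^ suc k S.* θ i f S.+ natℚ (suc k) · (f ^ suc k S.* θ i f)
        ≈⟨ (λ α _ → solve 2 (λ n z → z :+ n :* z := (con 1ℚ :+ n) :* z) refl
                      (natℚ (suc k)) ((f ^ suc k S.* θ i f) α)) ⟩
      natℚ (suc (suc k)) · (f ^ suc k S.* θ i f) ∎
      where open +-*-Solver

    partialSum-suc : ∀ t n → partialSum t (suc n) ≈ partialSum t n S.+ t n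
    partialSum-suc t n α _ = ∑-applyUpTo-suc (λ k → t k α) n

    θ-logTerm : ∀ u k → θ i (logTerm u k) ≈ sign k · (u ^ k S.* θ i u)
    θ-logTerm u k = begin
      θ i (logTerm u k)                                        ≈⟨ θ-· c (u ^ suc k) ⟩
      c · θ i (u ^ suc k)                                      ≈⟨ ·-cong c (θ-^ u k) ⟩
      c · (natℚ (suc k) · (u ^ k S.* θ i u))                   ≈⟨ (λ α _ → sym (ℚ.*-assoc c (natℚ (suc k)) _)) ⟩
      (c ℚ.* natℚ (suc k)) · (u ^ k S.* θ i u)
        ≈⟨ (λ α _ → cong (ℚ._* (u ^ k S.* θ i u) α) (/-natℚ (ℤ.-1ℤ ℤ.^ k) (suc k))) ⟩
      sign k · (u ^ k S.* θ i u)                               ∎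
      where c = (ℤ.-1ℤ ℤ.^ k) ℚ./ suc k

    -- The product telescopes, since (1 + u) · (- u)ᵏ = (- u)ᵏ - (- u)ᵏ⁺¹.
    θ-partialLog : ∀ f n → let u = minusOne f in
      f S.* θ i (partialSum (logTerm u) n) ≈ θ i u S.+ (ℚ.- sign n) · (u ^ n S.* θ i u)
    θ-partialLog f zero    = begin
      f S.* θ i S.0#    ≈⟨ *-congˡ {f} (λ α _ → ℚ.*-zeroʳ (natℚ (lookup α i))) ⟩
      f S.* S.0#        ≈⟨ zeroʳ f ⟩
      S.0#              ≈⟨ (λ α _ → solve 1 (λ z → con 0ℚ := z :+ (:- con 1ℚ) :* z) refl (θ i (minusOne f) α)) ⟩
      θ i u S.+ (ℚ.- sign 0) · θ i u                       ≈⟨ +-congˡ {θ i u} (·-cong (ℚ.- sign 0) (*-identityˡ (θ i u))) ⟨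
      θ i u S.+ (ℚ.- sign 0) · (S.1# S.* θ i u)            ∎
      where
      open +-*-Solver
      u = minusOne f
    θ-partialLog f (suc n) = begin
      f S.* θ i (partialSum (logTerm u) (suc n))
        ≈⟨ *-congˡ {f} (≈-trans (θ-cong (partialSum-suc (logTerm u) n)) (θ-+ L (logTerm u n))) ⟩
      f S.* (θ i L S.+ θ i (logTerm u n))
        ≈⟨ distribˡ f (θ i L) (θ i (logTerm u n)) ⟩
      f S.* θ i L S.+ f S.* θ i (logTerm u n)
        ≈⟨ +-cong (θ-partialLog f n) (*-cong f≈1+u (θ-logTerm u n)) ⟩
      (θ i u S.+ (ℚ.- s) · w) S.+ (S.1# S.+ u) S.* (s · w)
        ≈⟨ +-congˡ {θ i u S.+ (ℚ.- s) · w} (≈-trans (*-·ʳ s (S.1# S.+ u) w) (·-cong s (≈-trans (distribʳ w S.1# u)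
             (+-cong (*-identityˡ w) (≈-sym (*-assoc u (u ^ n) (θ i u))))))) ⟩
      (θ i u S.+ (ℚ.- s) · w) S.+ s · (w S.+ w′)
        ≈⟨ (λ α _ → solve 4 (λ a s w w′ → (a :+ (:- s) :* w) :+ s :* (w :+ w′) := a :+ (:- (:- s)) :* w′)
                      refl (θ i u α) s (w α) (w′ α)) ⟩
      θ i u S.+ (ℚ.- (ℚ.- s)) · w′
        ≈⟨ (λ α _ → cong (λ r → θ i u α ℚ.+ (ℚ.- r) ℚ.* w′ α) (sym (sign-suc n))) ⟩
      θ i u S.+ (ℚ.- sign (suc n)) · w′ ∎
      where
      open +-*-Solver
      u = minusOne f
      L = partialSum (logTerm u) n
      s = sign n
      w = u ^ n S.* θ i u
      w′ = u ^ suc n S.* θ i u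
      f≈1+u : f ≈ S.1# S.+ u
      f≈1+u α _ = solve 2 (λ f o → f := o :+ (f :+ :- o)) refl (f α) (S.1# α)

    -- The derivative of each term is the preceding term times `θ i h`, so the partial sum loses one
    -- term.
    θ-partialExp : ∀ h n → θ i (partialSum (expTerm h) (suc n)) ≈ partialSum (expTerm h) n S.* θ i h
    θ-partialExp h zero    = begin
      θ i (partialSum (expTerm h) 1)    ≈⟨ θ-cong (λ α _ → trans (ℚ.+-identityʳ (1ℚ ℚ.* S.1# α)) (ℚ.*-identityˡ _)) ⟩
      θ i S.1#                          ≈⟨ θ-1 ⟩
      S.0#                              ≈⟨ zeroˡ (θ i h) ⟨
      S.0# S.* θ i h                    ∎
    θ-partialExp h (suc n) = begin
      θ i (partialSum (expTerm h) (suc (suc n)))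
        ≈⟨ ≈-trans (θ-cong (partialSum-suc (expTerm h) (suc n))) (θ-+ (partialSum (expTerm h) (suc n)) _) ⟩
      θ i (partialSum (expTerm h) (suc n)) S.+ θ i (expTerm h (suc n))
        ≈⟨ +-cong (θ-partialExp h n) (≈-trans (θ-· c (h ^ suc n)) (·-cong c (θ-^ h n))) ⟩
      partialSum (expTerm h) n S.* θ i h S.+ c · (natℚ (suc n) · (h ^ n S.* θ i h))
        ≈⟨ (λ α _ → cong ((partialSum (expTerm h) n S.* θ i h) α ℚ.+_) (trans (sym (ℚ.*-assoc c (natℚ (suc n)) _))
             (cong (ℚ._* (h ^ n S.* θ i h) α) (trans (ℚ.*-comm c _) (invFactorial-suc n))))) ⟩
      partialSum (expTerm h) n S.* θ i h S.+ invFactorial n · (h ^ n S.* θ i h)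
        ≈⟨ +-congˡ {partialSum (expTerm h) n S.* θ i h} (·-*ˡ (invFactorial n) (h ^ n) (θ i h)) ⟨
      partialSum (expTerm h) n S.* θ i h S.+ expTerm h n S.* θ i h
        ≈⟨ distribʳ (θ i h) (partialSum (expTerm h) n) (expTerm h n) ⟨
      (partialSum (expTerm h) n S.+ expTerm h n) S.* θ i h
        ≈⟨ *-congʳ {θ i h} (partialSum-suc (expTerm h) n) ⟨
      partialSum (expTerm h) (suc n) S.* θ i h ∎
      where c = invFactorial (suc n)

    log-partial : ∀ f → f (replicate p 0) ≡ 1ℚ → log f ≈ partialSum (logTerm (minusOne f)) N
    log-partial f f0≡1 α α<N = ∑-applyUpTo-stable (λ k → logTerm u k α) (Vec.sum α)
      (λ k α≤k → trans (cong (((ℤ.-1ℤ ℤ.^ k) ℚ./ suc k) ℚ.*_) (^-order u (minusOne-0 f f0≡1) (suc k) α (ℕ.s≤s α≤k)))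
                       (ℚ.*-zeroʳ ((ℤ.-1ℤ ℤ.^ k) ℚ./ suc k)))
      (ℕ.<⇒≤ α<N)
      where u = minusOne f

    -- The number of terms is left free above N because differentiation relates partial sums of
    -- lengths N + 1 and N.
    exp-partial : ∀ h → h (replicate p 0) ≡ 0ℚ → ∀ {n} → N ℕ.≤ n → exp h ≈ partialSum (expTerm h) n
    exp-partial h h0≡0 N≤n α α<N = ∑-applyUpTo-stable (λ k → expTerm h k α) (suc (Vec.sum α))
      (λ k α<k → trans (cong (invFactorial k ℚ.*_) (^-order h h0≡0 k α α<k)) (ℚ.*-zeroʳ (invFactorial k)))
      (ℕ.≤-trans α<N N≤n)

    -- The remainder of the telescoping product is a multiple of `u ^ N`, which vanishes modulo
    -- degree N. Keeping the factor `f` on the left avoids division.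
    θ-log : ∀ f → f (replicate p 0) ≡ 1ℚ → f S.* θ i (log f) ≈ θ i f
    θ-log f f0≡1 = begin
      f S.* θ i (log f)                                ≈⟨ *-congˡ {f} (θ-cong (log-partial f f0≡1)) ⟩
      f S.* θ i (partialSum (logTerm u) N)             ≈⟨ θ-partialLog f N ⟩
      θ i u S.+ (ℚ.- sign N) · (u ^ N S.* θ i u)
        ≈⟨ +-cong (θ-minusOne f) (·-cong (ℚ.- sign N) (≈-trans (*-congʳ {θ i u} u^N≈0) (zeroˡ (θ i u)))) ⟩
      θ i f S.+ (ℚ.- sign N) · S.0#                    ≈⟨ (λ α _ → cong (θ i f α ℚ.+_) (ℚ.*-zeroʳ (ℚ.- sign N))) ⟩
      θ i f S.+ S.0#                                   ≈⟨ +-identityʳ (θ i f) ⟩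
      θ i f                                            ∎
      where
      u = minusOne f
      u^N≈0 : u ^ N ≈ S.0#
      u^N≈0 = ^-order u (minusOne-0 f f0≡1) N

    θ-exp : ∀ h → h (replicate p 0) ≡ 0ℚ → θ i (exp h) ≈ exp h S.* θ i h
    θ-exp h h0≡0 = begin
      θ i (exp h)                            ≈⟨ θ-cong (exp-partial h h0≡0 (ℕ.n≤1+n N)) ⟩
      θ i (partialSum (expTerm h) (suc N))   ≈⟨ θ-partialExp h N ⟩
      partialSum (expTerm h) N S.* θ i h     ≈⟨ *-congʳ {θ i h} (exp-partial h h0≡0 ℕ.≤-refl) ⟨
      exp h S.* θ i h                        ∎

    power-ode : ∀ f k → f S.* θ i (f ^ k) ≈ natℚ k · (f ^ k S.* θ i f)
    power-ode f zero    = begin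
      f S.* θ i S.1#    ≈⟨ *-congˡ {f} θ-1 ⟩
      f S.* S.0#        ≈⟨ zeroʳ f ⟩
      S.0#              ≈⟨ (λ α _ → ℚ.*-zeroˡ ((S.1# S.* θ i f) α)) ⟨
      0ℚ · (S.1# S.* θ i f) ∎
    power-ode f (suc k) = begin
      f S.* θ i (f ^ suc k)                            ≈⟨ *-congˡ {f} (θ-^ f k) ⟩
      f S.* (natℚ (suc k) · (f ^ k S.* θ i f))         ≈⟨ *-·ʳ (natℚ (suc k)) f (f ^ k S.* θ i f) ⟩
      natℚ (suc k) · (f S.* (f ^ k S.* θ i f))         ≈⟨ ·-cong (natℚ (suc k)) (*-assoc f (f ^ k) (θ i f)) ⟨
      natℚ (suc k) · (f ^ suc k S.* θ i f)             ∎

    ^ˢ-ode : ∀ f → f (replicate p 0) ≡ 1ℚ → ∀ a → f S.* θ i (f ^ˢ a) ≈ a · (f ^ˢ a S.* θ i f)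
    ^ˢ-ode f f0≡1 a = begin
      f S.* θ i (f ^ˢ a)
        ≈⟨ *-congˡ {f} (≈-trans (θ-exp (a · log f) (·-log-0 f a)) (*-congˡ {f ^ˢ a} (θ-· a (log f)))) ⟩
      f S.* (f ^ˢ a S.* a · θ i (log f))      ≈⟨ *-congˡ {f} (*-·ʳ a (f ^ˢ a) (θ i (log f))) ⟩
      f S.* a · (f ^ˢ a S.* θ i (log f))      ≈⟨ *-·ʳ a f (f ^ˢ a S.* θ i (log f)) ⟩
      a · (f S.* (f ^ˢ a S.* θ i (log f)))    ≈⟨ ·-cong a (*-assoc f (f ^ˢ a) (θ i (log f))) ⟨
      a · (f S.* f ^ˢ a S.* θ i (log f))      ≈⟨ ·-cong a (*-congʳ {θ i (log f)} (*-comm f (f ^ˢ a))) ⟩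
      a · (f ^ˢ a S.* f S.* θ i (log f))      ≈⟨ ·-cong a (*-assoc (f ^ˢ a) f (θ i (log f))) ⟩
      a · (f ^ˢ a S.* (f S.* θ i (log f)))    ≈⟨ ·-cong a (*-congˡ {f ^ˢ a} (θ-log f f0≡1)) ⟩
      a · (f ^ˢ a S.* θ i f)                  ∎

    -- With f = 1 + u the equation reads θᵢ g = a · g · θᵢ f - u · θᵢ g. Neither u nor θᵢ f has a
    -- constant term, so the coefficient of the right side at α depends only on coefficients of g of
    -- smaller degree.
    ode-unique-≤ : ∀ f g g′ a → f (replicate p 0) ≡ 1ℚ →
      f S.* θ i g ≈ a · (g S.* θ i f) → f S.* θ i g′ ≈ a · (g′ S.* θ i f) →
      ∀ α → Vec.sum α ℕ.< N → (∀ β → Vec.sum β ℕ.< Vec.sum α → g β ≡ g′ β) → θ i g α ≡ θ i g′ α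
    ode-unique-≤ f g g′ a f0≡1 ode ode′ α α<N g≡g′ =
      trans (expand g ode) (trans (cong₂ (λ y z → a ℚ.* y ℚ.- z) θf-local u-local) (sym (expand g′ ode′)))
      where
      u = minusOne f

      expand : ∀ g → f S.* θ i g ≈ a · (g S.* θ i f) → θ i g α ≡ a ℚ.* (θ i f ⊛ g) α ℚ.- (u ⊛ θ i g) α
      expand g ode = trans
        (solve 2 (λ y z → y := (y :+ z) :+ :- z) refl (θ i g α) ((u ⊛ θ i g) α))
        (cong (ℚ._- (u ⊛ θ i g) α) (trans
          (sym (trans (*≡⊛ f (θ i g) α) (trans
            (⊛-cong {f = f} {f′ = S.1# S.+ u} {g = θ i g}
              (λ α → solve 2 (λ f o → f := o :+ (f :+ :- o)) refl (f α) (S.1# α)) (λ _ → refl) α)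
            (trans (⊛-distribʳ (θ i g) S.1# u α) (cong (ℚ._+ (u ⊛ θ i g) α) (⊛-identityˡ (θ i g) α))))))
          (trans (ode α α<N) (cong (a ℚ.*_) (trans (*≡⊛ g (θ i f) α) (⊛-comm g (θ i f) α))))))
        where open +-*-Solver

      θf-local : (θ i f ⊛ g) α ≡ (θ i f ⊛ g′) α
      θf-local = ⊛-local (θ i f) g g′
        (trans (cong (λ n → natℚ n ℚ.* f (replicate p 0)) (Vec.lookup-replicate i 0)) (ℚ.*-zeroˡ (f (replicate p 0))))
        α g≡g′

      u-local : (u ⊛ θ i g) α ≡ (u ⊛ θ i g′) α
      u-local = ⊛-local u (θ i g) (θ i g′) (minusOne-0 f f0≡1) α
        (λ β β<α → cong (natℚ (lookup β i) ℚ.*_) (g≡g′ β β<α))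

  -- Induction on the degree bound N. At a nonzero exponent the equation for a variable that occurs
  -- in it is used, and the positive exponent of that variable is cancelled.
  ode-unique : ∀ f g g′ a → f (replicate p 0) ≡ 1ℚ → g (replicate p 0) ≡ g′ (replicate p 0) →
    (∀ i α → (f S.* θ i g) α ≡ a ℚ.* (g S.* θ i f) α) →
    (∀ i α → (f S.* θ i g′) α ≡ a ℚ.* (g′ S.* θ i f) α) →
    ∀ N α → Vec.sum α ℕ.< N → g α ≡ g′ α
  ode-unique f g g′ a f0≡1 g0≡ ode ode′ (suc N) α (ℕ.s≤s α≤N) with positive-entry α
  ... | inj₁ refl           = g0≡
  ... | inj₂ (i , m , αi≡m) = *-cancelˡ (natℚ-suc≢0 m)
    (subst (λ n → natℚ n ℚ.* g α ≡ natℚ n ℚ.* g′ α) αi≡m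
      (ode-unique-≤ (suc N) i f g g′ a f0≡1 (λ β _ → ode i β) (λ β _ → ode′ i β) α (ℕ.s≤s α≤N)
        (λ β β<α → ode-unique f g g′ a f0≡1 g0≡ ode ode′ N β (ℕ.<-≤-trans β<α α≤N))))

  ^-0 : ∀ f → f (replicate p 0) ≡ 1ℚ → ∀ k → (f ^ k) (replicate p 0) ≡ 1ℚ
  ^-0 f f0≡1 zero    = one-0 p
  ^-0 f f0≡1 (suc k) = trans (*≡⊛ f (f ^ k) (replicate p 0))
    (trans (⊛-0 p f (f ^ k)) (cong₂ ℚ._*_ f0≡1 (^-0 f f0≡1 k)))

  exp-0 : ∀ h → exp h (replicate p 0) ≡ 1ℚ
  exp-0 h = trans (cong (λ n → partialSum (expTerm h) (suc n) (replicate p 0)) (sum-replicate-0 p))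
    (trans (ℚ.+-identityʳ _) (trans (ℚ.*-identityˡ _) (one-0 p)))

  ^ˢ-natℚ : ∀ f → f (replicate p 0) ≡ 1ℚ → ∀ k α → (f ^ˢ natℚ k) α ≡ (f ^ k) α
  ^ˢ-natℚ f f0≡1 k α = ode-unique f (f ^ˢ natℚ k) (f ^ k) (natℚ k) f0≡1
    (trans (exp-0 (natℚ k · log f)) (sym (^-0 f f0≡1 k)))
    -- The equations hold modulo every degree; the coefficient at β is read off with the bound one
    -- above the degree of β.
    (λ i β → ^ˢ-ode (suc (Vec.sum β)) i f f0≡1 (natℚ k) β ℕ.≤-refl)
    (λ i β → power-ode (suc (Vec.sum β)) i f k β ℕ.≤-refl)
    (suc (Vec.sum α)) α ℕ.≤-refl

-- The coefficients of the independence series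

module Coefficients where

  open Rational
  open Convolution
  open ℚ⟦x⟧ using (Series; ∑; exp; X; B)

  private module S {p} = RawRing (ℚ⟦x⟧.seriesRing p)
  private module S^ {p} = RawSemiringOps (S.rawSemiring {p})
  open ≡-Reasoning

  invFactorials : ∀ {p} → Vec ℕ p → ℚ
  invFactorials l = Vec.foldr′ ℚ._*_ 1ℚ (Vec.map invFactorial l)

  support : ∀ {p} → Vec ℕ p → Subset p
  support []          = []
  support (zero ∷ α)  = outside ∷ support α
  support (suc n ∷ α) = inside ∷ support α

  -- The length has the shape `suc (n + j)` because `exp` is truncated at the total degree of
  -- `n ∷ α`, with `j` the degree of `α`.
  ∑-single : ∀ (F : ℕ → ℚ) n → (∀ k → k ≢ n → F k ≡ 0ℚ) → ∀ j → ∑ (applyUpTo F (suc (n ℕ.+ j))) ≡ F n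
  ∑-single F zero    F≡0 j = trans
    (cong (F 0 ℚ.+_) (sym (∑-applyUpTo-stable (F ∘ suc) 0 (λ k _ → F≡0 (suc k) λ ()) {j} ℕ.z≤n)))
    (ℚ.+-identityʳ (F 0))
  ∑-single F (suc n) F≡0 j = trans
    (cong₂ ℚ._+_ (F≡0 0 λ ()) (∑-single (F ∘ suc) n (λ k k≢n → F≡0 (suc k) (k≢n ∘ ℕ.suc-injective)) j))
    (ℚ.+-identityˡ (F (suc n)))

  *-cong : ∀ {p} {f f′ g g′ : Series p} → (∀ α → f α ≡ f′ α) → (∀ α → g α ≡ g′ α) →
           ∀ α → (f S.* g) α ≡ (f′ ⊛ g′) α
  *-cong {f = f} {g = g} f≡ g≡ α = trans (*≡⊛ f g α) (⊛-cong f≡ g≡ α)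

  -- The inclusion of the series free of the first variable. The factors with index `suc i` lie in
  -- its image, which permits recursion on the number of variables.
  lift : ∀ {p} → Series p → Series (suc p)
  lift f (zero ∷ α)  = f α
  lift f (suc n ∷ α) = 0ℚ

  lift-⊛ : ∀ {p} (f : Series p) g n α → (lift f ⊛ g) (n ∷ α) ≡ (f ⊛ at n g) α
  lift-⊛ f g zero    α = refl
  lift-⊛ f g (suc n) α = trans
    (cong ((f ⊛ at (suc n) g) α ℚ.+_) (⊛-zeroˡ g (n ∷ α)))
    (ℚ.+-identityʳ _)

  lift-⊛-lift : ∀ {p} (f g : Series p) α → (lift f ⊛ lift g) α ≡ lift (f ⊛ g) α
  lift-⊛-lift f g (zero ∷ α)  = refl
  lift-⊛-lift f g (suc n ∷ α) = trans (lift-⊛ f (lift g) (suc n) α) (⊛-zeroʳ f α)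

  lift-one : ∀ {p} (α : Vec ℕ (suc p)) → one α ≡ lift one α
  lift-one (zero ∷ α)  = refl
  lift-one (suc n ∷ α) = refl

  lift-X : ∀ {p} (i : Fin p) α → X (suc i) α ≡ lift (X i) α
  lift-X i (zero ∷ α)  = refl
  lift-X i (suc n ∷ α) = refl

  lift-^ : ∀ {p} {f : Series p} {g} → (∀ α → g α ≡ lift f α) →
           ∀ k α → (g S^.^ k) α ≡ lift (f S^.^ k) α
  lift-^ g≡ zero    α = lift-one α
  lift-^ {f = f} {g} g≡ (suc k) α = trans
    (*-cong g≡ (lift-^ g≡ k) α)
    (trans (lift-⊛-lift f (f S^.^ k) α) (lift-cong α))
    where
    lift-cong : ∀ α → lift (f ⊛ f S^.^ k) α ≡ lift (f S^.^ suc k) α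
    lift-cong (zero ∷ α)  = sym (*≡⊛ f (f S^.^ k) α)
    lift-cong (suc n ∷ α) = refl

  lift-exp : ∀ {p} {f : Series p} {g} → (∀ α → g α ≡ lift f α) →
             ∀ α → exp g α ≡ lift (exp f) α
  lift-exp {f = f} {g} g≡ (zero ∷ α)  =
    ∑-applyUpTo-cong (λ k → cong (invFactorial k ℚ.*_) (lift-^ g≡ k (0 ∷ α))) (suc (Vec.sum α))
  lift-exp {f = f} {g} g≡ (suc n ∷ α) = sym (∑-applyUpTo-stable
    (λ k → invFactorial k ℚ.* (g S^.^ k) (suc n ∷ α)) 0
    (λ k _ → trans (cong (invFactorial k ℚ.*_) (lift-^ g≡ k (suc n ∷ α))) (ℚ.*-zeroʳ (invFactorial k)))
    {suc (suc n ℕ.+ Vec.sum α)} ℕ.z≤n)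

  δ : ℕ → ℕ → ℚ
  δ m n = if does (m ℕ.≟ n) then 1ℚ else 0ℚ

  -- Multiplication by x₁ moves the first exponent by one, because `at 0 (X zero)` vanishes and
  -- `shift (X zero)` is `one`.
  X₀-^ : ∀ {p} k n (α : Vec ℕ p) → (X zero S^.^ k) (n ∷ α) ≡ δ k n ℚ.* one α
  X₀-^ zero    zero    α = sym (ℚ.*-identityˡ (one α))
  X₀-^ zero    (suc n) α = sym (ℚ.*-zeroˡ (one α))
  X₀-^ (suc k) zero    α = trans (*≡⊛ (X zero) (X zero S^.^ k) (0 ∷ α))
    (trans (⊛-zeroˡ (at 0 (X zero S^.^ k)) α) (sym (ℚ.*-zeroˡ (one α))))
  X₀-^ {p} (suc k) (suc n) α = begin
    (X zero S^.^ suc k) (suc n ∷ α)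
      ≡⟨ *≡⊛ (X zero) f (suc n ∷ α) ⟩
    ((λ _ → 0ℚ) ⊛ at (suc n) f) α ℚ.+ (shift (X zero) ⊛ f) (n ∷ α)
      ≡⟨ cong₂ ℚ._+_ (⊛-zeroˡ (at (suc n) f) α)
           (trans (⊛-cong {g = f} (λ { (m ∷ β) → shift-X₀ m β }) (λ _ → refl) (n ∷ α))
                  (⊛-identityˡ f (n ∷ α))) ⟩
    0ℚ ℚ.+ f (n ∷ α)                ≡⟨ ℚ.+-identityˡ (f (n ∷ α)) ⟩
    f (n ∷ α)                       ≡⟨ X₀-^ k n α ⟩
    δ k n ℚ.* one α                 ≡⟨⟩
    δ (suc k) (suc n) ℚ.* one α     ∎
    where
    f = X zero S^.^ k
    shift-X₀ : ∀ m (β : Vec ℕ p) → X zero (suc m ∷ β) ≡ one (m ∷ β)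
    shift-X₀ zero    β = refl
    shift-X₀ (suc m) β = refl

  δ-refl : ∀ n → δ n n ≡ 1ℚ
  δ-refl zero    = refl
  δ-refl (suc n) = δ-refl n

  δ-≢ : ∀ k n → k ≢ n → δ k n ≡ 0ℚ
  δ-≢ zero    zero    k≢n = contradiction refl k≢n
  δ-≢ zero    (suc n) k≢n = refl
  δ-≢ (suc k) zero    k≢n = refl
  δ-≢ (suc k) (suc n) k≢n = δ-≢ k n (k≢n ∘ cong suc)

  exp-X₀ : ∀ {p} n (α : Vec ℕ p) → exp (X zero) (n ∷ α) ≡ invFactorial n ℚ.* one α
  exp-X₀ n α = trans (∑-single F n F≡0 (Vec.sum α))
    (cong (invFactorial n ℚ.*_) (trans (X₀-^ n n α) (trans (cong (ℚ._* one α) (δ-refl n)) (ℚ.*-identityˡ (one α)))))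
    where
    F : ℕ → ℚ
    F k = invFactorial k ℚ.* (X zero S^.^ k) (n ∷ α)
    F≡0 : ∀ k → k ≢ n → F k ≡ 0ℚ
    F≡0 k k≢n = begin
      F k                                     ≡⟨ cong (invFactorial k ℚ.*_) (X₀-^ k n α) ⟩
      invFactorial k ℚ.* (δ k n ℚ.* one α)    ≡⟨ cong (λ d → invFactorial k ℚ.* (d ℚ.* one α)) (δ-≢ k n k≢n) ⟩
      invFactorial k ℚ.* (0ℚ ℚ.* one α)
        ≡⟨ solve 2 (λ a b → a :* (con 0ℚ :* b) := con 0ℚ) refl (invFactorial k) (one α) ⟩
      0ℚ                                      ∎
      where open +-*-Solver

  factor : ∀ {p} → Fin p → Series p
  factor i = exp (X i) S.+ (S.- S.1#)

  ∏factor : ∀ {p} → List (Fin p) → Series p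
  ∏factor L = foldr S._*_ S.1# (List.map factor L)

  subsetTerm : ∀ {p} → Subset p → Series p
  subsetTerm {p} I = ∏factor (filter (_∈? I) (allFin p))

  factor-zero : ∀ {p} n (α : Vec ℕ p) → factor zero (suc n ∷ α) ≡ invFactorial (suc n) ℚ.* one α
  factor-zero n α = trans (ℚ.+-identityʳ _) (exp-X₀ (suc n) α)

  factor-zero-0 : ∀ {p} (α : Vec ℕ p) → factor zero (0 ∷ α) ≡ 0ℚ
  factor-zero-0 α = trans (cong (ℚ._- one α) (trans (exp-X₀ 0 α) (ℚ.*-identityˡ (one α))))
                          (ℚ.+-inverseʳ (one α))

  lift-factor : ∀ {p} (i : Fin p) α → factor (suc i) α ≡ lift (factor i) α
  lift-factor i (zero ∷ α)  = cong (ℚ._- one α) (lift-exp (lift-X i) (0 ∷ α))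
  lift-factor i (suc n ∷ α) = trans (ℚ.+-identityʳ _) (lift-exp (lift-X i) (suc n ∷ α))

  lift-∏factor : ∀ {p} (L : List (Fin p)) α → ∏factor (List.map suc L) α ≡ lift (∏factor L) α
  lift-∏factor []      α = lift-one α
  lift-∏factor (i ∷ L) α = trans
    (*-cong (lift-factor i) (lift-∏factor L) α)
    (trans (lift-⊛-lift (factor i) (∏factor L) α) (lift-cong α))
    where
    lift-cong : ∀ α → lift (factor i ⊛ ∏factor L) α ≡ lift (∏factor (i ∷ L)) α
    lift-cong (zero ∷ α)  = sym (*≡⊛ (factor i) (∏factor L) α)
    lift-cong (suc n ∷ α) = refl

  filter-suc : ∀ {p} s (I : Subset p) (L : List (Fin p)) →
               filter (_∈? (s ∷ I)) (List.map suc L) ≡ List.map suc (filter (_∈? I) L)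
  filter-suc s I []      = refl
  filter-suc s I (i ∷ L) with does (i ∈? I)
  ... | true  = cong (suc i ∷_) (filter-suc s I L)
  ... | false = filter-suc s I L

  lift-subsetTerm : ∀ {p} s (I : Subset p) α →
    ∏factor (filter (_∈? (s ∷ I)) (List.tabulate suc)) α ≡ lift (subsetTerm I) α
  lift-subsetTerm {p} s I α = begin
    ∏factor (filter (_∈? (s ∷ I)) (List.tabulate suc)) α
      ≡⟨ cong (λ L → ∏factor (filter (_∈? (s ∷ I)) L) α) (List.map-tabulate id suc) ⟨
    ∏factor (filter (_∈? (s ∷ I)) (List.map suc (allFin p))) α
      ≡⟨ cong (λ L → ∏factor L α) (filter-suc s I (allFin p)) ⟩
    ∏factor (List.map suc (filter (_∈? I) (allFin p))) α
      ≡⟨ lift-∏factor (filter (_∈? I) (allFin p)) α ⟩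
    lift (subsetTerm I) α ∎

  inside-term : ∀ {p} (I : Subset p) n α → subsetTerm (inside ∷ I) (n ∷ α) ≡ (subsetTerm I ⊛ at n (factor zero)) α
  inside-term I n α = begin
    subsetTerm (inside ∷ I) (n ∷ α)
      ≡⟨ *-cong {f = factor zero} (λ _ → refl) (lift-subsetTerm inside I) (n ∷ α) ⟩
    (factor zero ⊛ lift (subsetTerm I)) (n ∷ α)
      -- `lift-⊛` requires the factor free of the first variable to stand on the left.
      ≡⟨ ⊛-comm (factor zero) (lift (subsetTerm I)) (n ∷ α) ⟩
    (lift (subsetTerm I) ⊛ factor zero) (n ∷ α)
      ≡⟨ lift-⊛ (subsetTerm I) (factor zero) n α ⟩
    (subsetTerm I ⊛ at n (factor zero)) α ∎

  inside-zero : ∀ {p} (I : Subset p) α → subsetTerm (inside ∷ I) (0 ∷ α) ≡ 0ℚ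
  inside-zero I α = trans (inside-term I 0 α)
    (trans (⊛-cong {f = subsetTerm I} (λ _ → refl) factor-zero-0 α) (⊛-zeroʳ (subsetTerm I) α))

  inside-suc : ∀ {p} (I : Subset p) n α →
               subsetTerm (inside ∷ I) (suc n ∷ α) ≡ invFactorial (suc n) ℚ.* subsetTerm I α
  inside-suc I n α = begin
    subsetTerm (inside ∷ I) (suc n ∷ α)
      ≡⟨ inside-term I (suc n) α ⟩
    (subsetTerm I ⊛ at (suc n) (factor zero)) α
      ≡⟨ ⊛-cong {f = subsetTerm I} (λ _ → refl) (factor-zero n) α ⟩
    (subsetTerm I ⊛ invFactorial (suc n) · one) α
      ≡⟨ ⊛-· (invFactorial (suc n)) (subsetTerm I) one α ⟩
    invFactorial (suc n) ℚ.* (subsetTerm I ⊛ one) α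
      ≡⟨ cong (invFactorial (suc n) ℚ.*_) (trans (⊛-comm (subsetTerm I) one α) (⊛-identityˡ (subsetTerm I) α)) ⟩
    invFactorial (suc n) ℚ.* subsetTerm I α ∎

  subsetTerm-support : ∀ {p} (α : Vec ℕ p) → subsetTerm (support α) α ≡ invFactorials α
  subsetTerm-support []          = refl
  subsetTerm-support (zero ∷ α)  = trans (lift-subsetTerm outside (support α) (0 ∷ α))
    (trans (subsetTerm-support α) (sym (ℚ.*-identityˡ (invFactorials α))))
  subsetTerm-support (suc n ∷ α) = trans (inside-suc (support α) n α)
    (cong (invFactorial (suc n) ℚ.*_) (subsetTerm-support α))

  -- The factor of i ∈ I contains only positive powers of xᵢ and no other variable, so every
  -- monomial of the product has support exactly I.
  subsetTerm-≢ : ∀ {p} (I : Subset p) α → I ≢ support α → subsetTerm I α ≡ 0ℚ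
  subsetTerm-≢ []            []          I≢ = contradiction refl I≢
  subsetTerm-≢ (outside ∷ I) (zero ∷ α)  I≢ =
    trans (lift-subsetTerm outside I (0 ∷ α)) (subsetTerm-≢ I α (I≢ ∘ cong (outside ∷_)))
  subsetTerm-≢ (outside ∷ I) (suc n ∷ α) I≢ = lift-subsetTerm outside I (suc n ∷ α)
  subsetTerm-≢ (inside ∷ I)  (zero ∷ α)  I≢ = inside-zero I α
  subsetTerm-≢ (inside ∷ I)  (suc n ∷ α) I≢ = trans (inside-suc I n α)
    (trans (cong (invFactorial (suc n) ℚ.*_) (subsetTerm-≢ I α (I≢ ∘ cong (inside ∷_))))
           (ℚ.*-zeroʳ (invFactorial (suc n))))

  ∑-filter : ∀ {A : Set} {P : A → Set} (P? : Unary.Decidable P) (F : A → ℚ) xs →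
             ∑ (List.map F (filter P? xs)) ≡ ∑ (List.map (λ x → if does (P? x) then F x else 0ℚ) xs)
  ∑-filter P? F []       = refl
  ∑-filter P? F (x ∷ xs) with does (P? x)
  ... | true  = cong (F x ℚ.+_) (∑-filter P? F xs)
  ... | false = trans (∑-filter P? F xs) (sym (ℚ.+-identityˡ _))

  subsets : ∀ p → List (Subset p)
  subsets p = vectors (outside ∷ inside ∷ []) p

  ∑-subsets-∷ : ∀ {p} (F : Subset (suc p) → ℚ) → ∑ (List.map F (subsets (suc p))) ≡
                ∑ (List.map (F ∘ (outside ∷_)) (subsets p)) ℚ.+ ∑ (List.map (F ∘ (inside ∷_)) (subsets p))
  ∑-subsets-∷ {p} F = begin
    ∑ (List.map F (List.map (outside ∷_) I List.++ List.map (inside ∷_) I List.++ []))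
      ≡⟨ cong (λ L → ∑ (List.map F (List.map (outside ∷_) I List.++ L))) (List.++-identityʳ _) ⟩
    ∑ (List.map F (List.map (outside ∷_) I List.++ List.map (inside ∷_) I))
      ≡⟨ cong ∑ (List.map-++ F (List.map (outside ∷_) I) _) ⟩
    ∑ (List.map F (List.map (outside ∷_) I) List.++ List.map F (List.map (inside ∷_) I))
      ≡⟨ ∑-++ (List.map F (List.map (outside ∷_) I)) _ ⟩
    ∑ (List.map F (List.map (outside ∷_) I)) ℚ.+ ∑ (List.map F (List.map (inside ∷_) I))
      ≡⟨ cong₂ (λ xs ys → ∑ xs ℚ.+ ∑ ys) (List.map-∘ I) (List.map-∘ I) ⟨
    ∑ (List.map (F ∘ (outside ∷_)) I) ℚ.+ ∑ (List.map (F ∘ (inside ∷_)) I) ∎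
    where I = subsets p

  ∑-zero : ∀ {A : Set} (F : A → ℚ) → (∀ x → F x ≡ 0ℚ) → ∀ xs → ∑ (List.map F xs) ≡ 0ℚ
  ∑-zero F F≡0 []       = refl
  ∑-zero F F≡0 (x ∷ xs) = cong₂ ℚ._+_ (F≡0 x) (∑-zero F F≡0 xs)

  ∑-subsets-single : ∀ {p} (F : Subset p → ℚ) J → (∀ I → I ≢ J → F I ≡ 0ℚ) →
                     ∑ (List.map F (subsets p)) ≡ F J
  ∑-subsets-single F []            F≡0 = ℚ.+-identityʳ (F [])
  ∑-subsets-single F (outside ∷ J) F≡0 = trans (∑-subsets-∷ F) (trans
    (cong₂ ℚ._+_ (∑-subsets-single (F ∘ (outside ∷_)) J (λ I I≢J → F≡0 (outside ∷ I) (I≢J ∘ cong Vec.tail)))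
                 (∑-zero (F ∘ (inside ∷_)) (λ I → F≡0 (inside ∷ I) λ ()) (subsets _)))
    (ℚ.+-identityʳ _))
  ∑-subsets-single F (inside ∷ J)  F≡0 = trans (∑-subsets-∷ F) (trans
    (cong₂ ℚ._+_ (∑-zero (F ∘ (outside ∷_)) (λ I → F≡0 (outside ∷ I) λ ()) (subsets _))
                 (∑-subsets-single (F ∘ (inside ∷_)) J (λ I I≢J → F≡0 (inside ∷ I) (I≢J ∘ cong Vec.tail))))
    (ℚ.+-identityˡ _))

  foldr-+ : ∀ {p} {A : Set} (F : A → Series p) xs α →
            foldr S._+_ S.0# (List.map F xs) α ≡ ∑ (List.map (λ x → F x α) xs)
  foldr-+ F []       α = refl
  foldr-+ F (x ∷ xs) α = cong (F x α ℚ.+_) (foldr-+ F xs α)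

  B-coefficient : ∀ {p} (H : Graph p) α →
    B H α ≡ (if does (independent? H (support α)) then invFactorials α else 0ℚ)
  B-coefficient {p} H α = begin
    B H α
      ≡⟨ foldr-+ subsetTerm (Ind H) α ⟩
    ∑ (List.map (λ I → subsetTerm I α) (Ind H))
      ≡⟨ ∑-filter (independent? H) (λ I → subsetTerm I α) (subsets p) ⟩
    ∑ (List.map F (subsets p))
      ≡⟨ ∑-subsets-single F (support α) F≡0 ⟩
    F (support α)
      ≡⟨ cong (λ z → if does (independent? H (support α)) then z else 0ℚ) (subsetTerm-support α) ⟩
    (if does (independent? H (support α)) then invFactorials α else 0ℚ) ∎
    where
    F : Subset p → ℚ
    F I = if does (independent? H I) then subsetTerm I α else 0ℚ
    F≡0 : ∀ I → I ≢ support α → F I ≡ 0ℚ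
    F≡0 I I≢ with does (independent? H I)
    ... | true  = subsetTerm-≢ I α I≢
    ... | false = refl

-- Partial derivatives, and block sizes counted vertex by vertex

module Derivative where

  open Rational
  open Convolution
  open Coefficients
  open ℚ⟦x⟧ using (Series)
  open SemiringSum (CommutativeRing.semiring ℚ.+-*-commutativeRing) using (sum)

  inc : ∀ {p} → Fin p → Vec ℕ p → Vec ℕ p
  inc i α = α [ i ]%= suc

  ∂ : ∀ {p} → Fin p → Series p → Series p
  ∂ i f α = natℚ (suc (lookup α i)) ℚ.* f (inc i α)

  ∂≡θ : ∀ {p} i (f : Series p) α → ∂ i f α ≡ θ i f (inc i α)
  ∂≡θ i f α = cong (λ n → natℚ n ℚ.* f (inc i α)) (sym (Vec.lookup∘updateAt i α))

  -- Division by xᵢ: the hypothesis says that xᵢ divides f, and then the product can be divided by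
  -- dividing f alone.
  ⊛-inc : ∀ {p} i (f g : Series p) → (∀ α → lookup α i ≡ 0 → f α ≡ 0ℚ) →
          ∀ α → (f ⊛ g) (inc i α) ≡ ((f ∘ inc i) ⊛ g) α
  ⊛-inc zero f g f≡0 (n ∷ α) = trans
    (cong₂ ℚ._+_
      (trans (⊛-cong {g = at (suc n) g} (λ β → f≡0 (0 ∷ β) refl) (λ _ → refl) α) (⊛-zeroˡ (at (suc n) g) α))
      (⊛-cong {g = g} (λ { (m ∷ β) → refl }) (λ _ → refl) (n ∷ α)))
    (ℚ.+-identityˡ _)
  ⊛-inc (suc j) f g f≡0 (zero ∷ α)  = ⊛-inc j (at 0 f) (at 0 g) (λ β → f≡0 (0 ∷ β)) α
  ⊛-inc (suc j) f g f≡0 (suc n ∷ α) = cong₂ ℚ._+_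
    (⊛-inc j (at 0 f) (at (suc n) g) (λ β → f≡0 (0 ∷ β)) α)
    (trans (⊛-inc (suc j) (shift f) g (λ { (m ∷ β) → f≡0 (suc m ∷ β) }) (n ∷ α))
           (⊛-cong {g = g} (λ { (m ∷ β) → refl }) (λ _ → refl) (n ∷ α)))

  θ-⊛-inc : ∀ {p} i (f g : Series p) α → (θ i f ⊛ g) (inc i α) ≡ (∂ i f ⊛ g) α
  θ-⊛-inc i f g α = trans
    (⊛-inc i (θ i f) g (λ β βi≡0 → trans (cong (λ n → natℚ n ℚ.* f β) βi≡0) (ℚ.*-zeroˡ (f β))) α)
    (⊛-cong {g = g} (λ β → sym (∂≡θ i f β)) (λ _ → refl) α)

  -- Inherited from the Leibniz rule for θᵢ = xᵢ ∂ᵢ: each of the two summands has a factor divisible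
  -- by xᵢ, and `⊛-inc` divides there.
  ∂-⊛ : ∀ {p} i (f g : Series p) α → ∂ i (f ⊛ g) α ≡ (∂ i f ⊛ g) α ℚ.+ (f ⊛ ∂ i g) α
  ∂-⊛ i f g α = begin
    ∂ i (f ⊛ g) α                                     ≡⟨ ∂≡θ i (f ⊛ g) α ⟩
    θ i (f ⊛ g) (inc i α)                             ≡⟨ θ-⊛ i f g (inc i α) ⟩
    (θ i f ⊛ g) (inc i α) ℚ.+ (f ⊛ θ i g) (inc i α)
      ≡⟨ cong₂ ℚ._+_ (θ-⊛-inc i f g α)
           (trans (⊛-comm f (θ i g) (inc i α)) (trans (θ-⊛-inc i g f α) (⊛-comm (∂ i g) f α))) ⟩
    (∂ i f ⊛ g) α ℚ.+ (f ⊛ ∂ i g) α                   ∎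
    where open ≡-Reasoning

  ∂-one : ∀ {p} i (α : Vec ℕ p) → ∂ i one α ≡ 0ℚ
  ∂-one i α = trans (cong (natℚ (suc (lookup α i)) ℚ.*_) (one-inc i α)) (ℚ.*-zeroʳ (natℚ (suc (lookup α i))))
    where
    one-inc : ∀ {p} i (α : Vec ℕ p) → one (inc i α) ≡ 0ℚ
    one-inc zero    (n ∷ α)     = refl
    one-inc (suc i) (zero ∷ α)  = one-inc i α
    one-inc (suc i) (suc n ∷ α) = refl

  ⊛-sum : ∀ {p k} (f : Series p) (g : Fin k → Series p) α →
          (f ⊛ λ β → sum (λ c → g c β)) α ≡ sum (λ c → (f ⊛ g c) α)
  ⊛-sum {k = zero}  f g α = ⊛-zeroʳ f α
  ⊛-sum {k = suc k} f g α = trans (⊛-distribˡ f (g zero) (λ β → sum (λ c → g (suc c) β)) α)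
    (cong ((f ⊛ g zero) α ℚ.+_) (⊛-sum f (g ∘ suc) α))

  invFactorials-inc : ∀ {p} i (α : Vec ℕ p) →
    natℚ (suc (lookup α i)) ℚ.* invFactorials (inc i α) ≡ invFactorials α
  invFactorials-inc zero    (n ∷ α) = trans
    (sym (ℚ.*-assoc (natℚ (suc n)) (invFactorial (suc n)) _))
    (cong (ℚ._* invFactorials α) (invFactorial-suc n))
  invFactorials-inc (suc i) (n ∷ α) = trans
    (solve 3 (λ a b c → a :* (b :* c) := b :* (a :* c)) refl
      (natℚ (suc (lookup α i))) (invFactorial n) (invFactorials (inc i α)))
    (cong (invFactorial n ℚ.*_) (invFactorials-inc i α))
    where open +-*-Solver

  invFactorials-0 : ∀ p → invFactorials (replicate p 0) ≡ 1ℚ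
  invFactorials-0 zero    = refl
  invFactorials-0 (suc p) = trans (ℚ.*-identityˡ _) (invFactorials-0 p)

  support-inc : ∀ {p} i (α : Vec ℕ p) → support (inc i α) ≡ ⁅ i ⁆ ∪ support α
  support-inc zero    (zero ∷ α)  = cong (inside ∷_) (sym (∪-identityˡ (support α)))
  support-inc zero    (suc n ∷ α) = cong (inside ∷_) (sym (∪-identityˡ (support α)))
  support-inc (suc i) (zero ∷ α)  = cong (outside ∷_) (support-inc i α)
  support-inc (suc i) (suc n ∷ α) = cong (inside ∷_) (support-inc i α)

  support-0 : ∀ p → support (replicate p 0) ≡ ⊥
  support-0 zero    = refl
  support-0 (suc p) = cong (outside ∷_) (support-0 p)

  -- The block sizes of an arbitrary assignment of vertices to blocks. For arbitrary assignments,
  -- removing the first vertex is mere composition with `suc`, as the induction over vertices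
  -- requires; `tally-block` returns to the blow-up.
  tally : ∀ {p n} → (Fin n → Fin p) → Vec ℕ p
  tally {p} {zero}  b = replicate p 0
  tally {p} {suc n} b = inc (b zero) (tally (b ∘ suc))

  tally-cong : ∀ {p n} {b b′ : Fin n → Fin p} → (∀ v → b v ≡ b′ v) → tally b ≡ tally b′
  tally-cong {n = zero}  b≡b′ = refl
  tally-cong {n = suc n} b≡b′ = cong₂ inc (b≡b′ zero) (tally-cong (b≡b′ ∘ suc))

  tally-suc : ∀ {p n} (b : Fin n → Fin p) → tally (suc ∘ b) ≡ 0 ∷ tally b
  tally-suc {n = zero}  b = refl
  tally-suc {n = suc n} b = cong (inc (suc (b zero))) (tally-suc (b ∘ suc))

  tally-block : ∀ {p} (l : Vec ℕ p) → tally (block l) ≡ l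
  tally-block []          = refl
  tally-block (zero ∷ l)  = trans (tally-suc (block l)) (cong (0 ∷_) (tally-block l))
  tally-block (suc m ∷ l) = cong (inc zero) (trans (tally-cong block-suc) (tally-block (m ∷ l)))
    where
    block-suc : ∀ v → block (suc m ∷ l) (suc v) ≡ block (m ∷ l) v
    block-suc v with splitAt m v
    ... | inj₁ _ = refl
    ... | inj₂ _ = refl

-- Counting proper colourings of blow-ups

module Colouring {p} (H : Graph p) where

  open Rational
  open Convolution
  open Coefficients
  open Derivative
  open Exponential using (^ˢ-natℚ)
  open ℚ⟦x⟧ using (Series; _^ˢ_; B; egf)
  open Existence using (count; count-product; count-≐)
  open SemiringSum (CommutativeRing.semiring ℚ.+-*-commutativeRing)
    using (sum; sum-cong-≗; *-distribʳ-sum)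

  private module S = RawRing (ℚ⟦x⟧.seriesRing p)
  open RawSemiringOps S.rawSemiring using (_^_)

  -- A colour class already meeting the blocks in S may be extended by μᵢ
  -- further vertices from each block i.
  extensions : Subset p → Series p
  extensions S μ = (if does (independent? H (S ∪ support μ)) then 1ℚ else 0ℚ) ℚ.* invFactorials μ

  -- Differentiation places one vertex of block i in the class: the weight μᵢ + 1 is absorbed by the
  -- inverse factorial, and i joins the support.
  ∂-extensions : ∀ i S μ → ∂ i (extensions S) μ ≡ extensions (S ∪ ⁅ i ⁆) μ
  ∂-extensions i S μ = begin
    natℚ (suc (lookup μ i)) ℚ.* (e (S ∪ support (inc i μ)) ℚ.* invFactorials (inc i μ))
      ≡⟨ cong (λ J → natℚ (suc (lookup μ i)) ℚ.* (e J ℚ.* invFactorials (inc i μ)))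
           (trans (cong (S ∪_) (support-inc i μ)) (sym (∪-assoc S ⁅ i ⁆ (support μ)))) ⟩
    natℚ (suc (lookup μ i)) ℚ.* (e ((S ∪ ⁅ i ⁆) ∪ support μ) ℚ.* invFactorials (inc i μ))
      ≡⟨ solve 3 (λ a b c → a :* (b :* c) := b :* (a :* c)) refl
           (natℚ (suc (lookup μ i))) (e ((S ∪ ⁅ i ⁆) ∪ support μ)) (invFactorials (inc i μ)) ⟩
    e ((S ∪ ⁅ i ⁆) ∪ support μ) ℚ.* (natℚ (suc (lookup μ i)) ℚ.* invFactorials (inc i μ))
      ≡⟨ cong (e ((S ∪ ⁅ i ⁆) ∪ support μ) ℚ.*_) (invFactorials-inc i μ) ⟩
    extensions (S ∪ ⁅ i ⁆) μ ∎
    where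
    open ≡-Reasoning
    open +-*-Solver
    e : Subset p → ℚ
    e J = if does (independent? H J) then 1ℚ else 0ℚ

  extensions-0 : ∀ S → extensions S (replicate p 0) ≡ (if does (independent? H S) then 1ℚ else 0ℚ)
  extensions-0 S = trans
    (cong₂ (λ J z → (if does (independent? H J) then 1ℚ else 0ℚ) ℚ.* z)
      (trans (cong (S ∪_) (support-0 p)) (∪-identityʳ S)) (invFactorials-0 p))
    (ℚ.*-identityʳ _)

  extensions-⊥ : ∀ μ → extensions ⊥ μ ≡ B H μ
  extensions-⊥ μ = trans
    (cong (λ J → (if does (independent? H J) then 1ℚ else 0ℚ) ℚ.* invFactorials μ) (∪-identityˡ (support μ)))
    (trans scale (sym (B-coefficient H μ)))
    where
    scale : (if does (independent? H (support μ)) then 1ℚ else 0ℚ) ℚ.* invFactorials μ ≡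
            (if does (independent? H (support μ)) then invFactorials μ else 0ℚ)
    scale with does (independent? H (support μ))
    ... | true  = ℚ.*-identityˡ (invFactorials μ)
    ... | false = ℚ.*-zeroˡ (invFactorials μ)

  B-0 : B H (replicate p 0) ≡ 1ℚ
  B-0 = trans (sym (extensions-⊥ (replicate p 0))) (trans (extensions-0 ⊥) ⊥-independent)
    where
    ⊥-independent : (if does (independent? H ⊥) then 1ℚ else 0ℚ) ≡ 1ℚ
    ⊥-independent = cong (λ d → if d then 1ℚ else 0ℚ)
      (dec-true (independent? H ⊥) (λ i j i∈⊥ → contradiction i∈⊥ ∉⊥))

  -- Each of the k colour classes is recorded only by the set of blocks that it meets; this
  -- suffices, as adjacency in a blow-up depends only on the blocks.
  Classes : ℕ → Set
  Classes k = Vec (Subset p) k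

  add : ∀ {k} → Fin k → Fin p → Classes k → Classes k
  add c i Ss = Ss [ c ]%= (_∪ ⁅ i ⁆)

  addAll : ∀ {n k} → (Fin n → Fin p) → Vec (Fin k) n → Classes k → Classes k
  addAll b []      Ss = Ss
  addAll b (c ∷ f) Ss = addAll (b ∘ suc) f (add c (b zero) Ss)

  independents? : ∀ {k} (Ss : Classes k) → _
  independents? Ss = all? (independent? H) Ss

  ∏extensions : ∀ {k} → Classes k → Series p
  ∏extensions []       = one
  ∏extensions (S ∷ Ss) = extensions S ⊛ ∏extensions Ss

  ∂-∏extensions : ∀ i {k} (Ss : Classes k) μ →
                  ∂ i (∏extensions Ss) μ ≡ sum (λ c → ∏extensions (add c i Ss) μ)
  ∂-∏extensions i []       μ = ∂-one i μ
  ∂-∏extensions i (S ∷ Ss) μ = begin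
    ∂ i (extensions S ⊛ ∏extensions Ss) μ
      ≡⟨ ∂-⊛ i (extensions S) (∏extensions Ss) μ ⟩
    (∂ i (extensions S) ⊛ ∏extensions Ss) μ ℚ.+ (extensions S ⊛ ∂ i (∏extensions Ss)) μ
      ≡⟨ cong₂ ℚ._+_
           (⊛-cong {g = ∏extensions Ss} (∂-extensions i S) (λ _ → refl) μ)
           (⊛-cong {f = extensions S} (λ _ → refl) (∂-∏extensions i Ss) μ) ⟩
    ∏extensions (add zero i (S ∷ Ss)) μ ℚ.+
      (extensions S ⊛ λ ν → sum (λ c → ∏extensions (add c i Ss) ν)) μ
      ≡⟨ cong (∏extensions (add zero i (S ∷ Ss)) μ ℚ.+_)
           (⊛-sum (extensions S) (λ c → ∏extensions (add c i Ss)) μ) ⟩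
    sum (λ c → ∏extensions (add c i (S ∷ Ss)) μ) ∎
    where open ≡-Reasoning

  -- Exponent 0 means that no vertex is left to colour, so the constant term merely tests whether
  -- all classes reached are independent.
  ∏extensions-0 : ∀ {k} (Ss : Classes k) →
    ∏extensions Ss (replicate p 0) ≡ (if does (independents? Ss) then 1ℚ else 0ℚ)
  ∏extensions-0 []       = one-0 p
  ∏extensions-0 (S ∷ Ss) = trans (⊛-0 p (extensions S) (∏extensions Ss))
    (trans (cong₂ ℚ._*_ (extensions-0 S) (∏extensions-0 Ss)) conjunction)
    where
    conjunction : (if does (independent? H S) then 1ℚ else 0ℚ) ℚ.* (if does (independents? Ss) then 1ℚ else 0ℚ) ≡
                  (if does (independents? (S ∷ Ss)) then 1ℚ else 0ℚ)
    conjunction with does (independent? H S)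
    ... | true  = ℚ.*-identityˡ _
    ... | false = ℚ.*-zeroˡ (if does (independents? Ss) then 1ℚ else 0ℚ)

  -- The initial classes are arbitrary because colouring the first vertex changes one of them.
  -- Multiplication by `N`, the size of the block of that vertex, turns the right side into a
  -- coefficient of ∂ᵢ, which splits over the k factors just as the count splits over the k colours.
  -- `N` is nonzero and can be cancelled afterwards.
  colouring-count : ∀ {n k} (b : Fin n → Fin p) (Ss : Classes k) →
    natℚ (count (λ f → independents? (addAll b f Ss)) (vectors (allFin k) n)) ℚ.* invFactorials (tally b)
    ≡ ∏extensions Ss (tally b)
  colouring-count {zero} {k} b Ss = trans
    (cong₂ ℚ._*_ single (invFactorials-0 p))
    (trans (ℚ.*-identityʳ _) (sym (∏extensions-0 Ss)))
    where
    single : natℚ (count (λ f → independents? (addAll b f Ss)) ([] ∷ [])) ≡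
             (if does (independents? Ss) then 1ℚ else 0ℚ)
    single with does (independents? Ss)
    ... | true  = refl
    ... | false = refl
  colouring-count {suc n} {k} b Ss = *-cancelˡ (natℚ-suc≢0 (lookup m i)) (begin
    N ℚ.* (total ℚ.* invFactorials (inc i m))
      ≡⟨ solve 3 (λ a b c → a :* (b :* c) := b :* (a :* c)) refl N total (invFactorials (inc i m)) ⟩
    total ℚ.* (N ℚ.* invFactorials (inc i m))
      ≡⟨ cong₂ ℚ._*_
           (count-product (λ f → independents? (addAll b f Ss)) _∷_ id (vectors (allFin k) n))
           (invFactorials-inc i m) ⟩
    sum (λ c → C c) ℚ.* invFactorials m
      ≡⟨ *-distribʳ-sum (invFactorials m) (λ c → C c) ⟩
    sum (λ c → C c ℚ.* invFactorials m)
      ≡⟨ sum-cong-≗ (λ c → colouring-count (b ∘ suc) (add c i Ss)) ⟩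
    sum (λ c → ∏extensions (add c i Ss) m)
      ≡⟨ ∂-∏extensions i Ss m ⟨
    N ℚ.* ∏extensions Ss (inc i m) ∎)
    where
    open ≡-Reasoning
    open +-*-Solver
    i = b zero
    m = tally (b ∘ suc)
    N = natℚ (suc (lookup m i))
    total = natℚ (count (λ f → independents? (addAll b f Ss)) (vectors (allFin k) (suc n)))
    C : Fin k → ℚ
    C c = natℚ (count (λ f → independents? (addAll (b ∘ suc) f (add c i Ss))) (vectors (allFin k) n))

  ∏extensions-⊥ : ∀ k μ → ∏extensions (replicate k ⊥) μ ≡ (B H ^ k) μ
  ∏extensions-⊥ zero    μ = refl
  ∏extensions-⊥ (suc k) μ = trans
    (⊛-cong extensions-⊥ (∏extensions-⊥ k) μ) (sym (*≡⊛ (B H) (B H ^ k) μ))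

  ∈-add⁻ : ∀ {k} (Ss : Classes k) c c′ i {j} → j ∈ lookup (add c i Ss) c′ →
           j ∈ lookup Ss c′ ⊎ (i ≡ j × c ≡ c′)
  ∈-add⁻ Ss c c′ i {j} j∈ with c Fin.≟ c′
  ... | no c≢c′ = inj₁ (subst (j ∈_) (Vec.lookup∘updateAt′ c′ c (c≢c′ ∘ sym) Ss) j∈)
  ... | yes refl with x∈p∪q⁻ (lookup Ss c) ⁅ i ⁆ (subst (j ∈_) (Vec.lookup∘updateAt c Ss) j∈)
  ...   | inj₁ j∈S = inj₁ j∈S
  ...   | inj₂ j∈i = inj₂ (sym (x∈⁅y⁆⇒x≡y i j∈i) , refl)

  ∈-add⁺ : ∀ {k} (Ss : Classes k) c c′ i {j} → j ∈ lookup Ss c′ ⊎ (i ≡ j × c ≡ c′) →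
           j ∈ lookup (add c i Ss) c′
  ∈-add⁺ Ss c c′ i {j} j∈ with c Fin.≟ c′
  ∈-add⁺ Ss c c  i {j} j∈ | yes refl = subst (j ∈_) (sym (Vec.lookup∘updateAt c Ss)) (x∈p∪q⁺ (member j∈))
    where
    member : j ∈ lookup Ss c ⊎ (i ≡ j × c ≡ c) → j ∈ lookup Ss c ⊎ j ∈ ⁅ i ⁆
    member (inj₁ j∈S)        = inj₁ j∈S
    member (inj₂ (refl , _)) = inj₂ (x∈⁅x⁆ i)
  ∈-add⁺ Ss c c′ i {j} (inj₁ j∈S) | no c≢c′ =
    subst (j ∈_) (sym (Vec.lookup∘updateAt′ c′ c (c≢c′ ∘ sym) Ss)) j∈S
  ∈-add⁺ Ss c c′ i (inj₂ (_ , c≡c′)) | no c≢c′ = contradiction c≡c′ c≢c′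

  ∈-addAll⁻ : ∀ {n k} (b : Fin n → Fin p) f (Ss : Classes k) {c j} → j ∈ lookup (addAll b f Ss) c →
              j ∈ lookup Ss c ⊎ ∃ λ v → b v ≡ j × lookup f v ≡ c
  ∈-addAll⁻ b []       Ss j∈ = inj₁ j∈
  ∈-addAll⁻ b (c′ ∷ f) Ss {c} j∈ with ∈-addAll⁻ (b ∘ suc) f (add c′ (b zero) Ss) j∈
  ... | inj₂ (v , bv≡j , fv≡c) = inj₂ (suc v , bv≡j , fv≡c)
  ... | inj₁ j∈′ with ∈-add⁻ Ss c′ c (b zero) j∈′
  ...   | inj₁ j∈Ss = inj₁ j∈Ss
  ...   | inj₂ eqs  = inj₂ (zero , eqs)

  ∈-addAll⁺ : ∀ {n k} (b : Fin n → Fin p) f (Ss : Classes k) {c j} →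
              j ∈ lookup Ss c ⊎ (∃ λ v → b v ≡ j × lookup f v ≡ c) → j ∈ lookup (addAll b f Ss) c
  ∈-addAll⁺ b []       Ss (inj₁ j∈)             = j∈
  ∈-addAll⁺ b (c′ ∷ f) Ss (inj₁ j∈)             =
    ∈-addAll⁺ (b ∘ suc) f _ (inj₁ (∈-add⁺ Ss c′ _ (b zero) (inj₁ j∈)))
  ∈-addAll⁺ b (c′ ∷ f) Ss (inj₂ (zero , eqs))   =
    ∈-addAll⁺ (b ∘ suc) f _ (inj₁ (∈-add⁺ Ss c′ _ (b zero) (inj₂ eqs)))
  ∈-addAll⁺ b (c′ ∷ f) Ss (inj₂ (suc v , eqs))  = ∈-addAll⁺ (b ∘ suc) f _ (inj₂ (v , eqs))

  module _ {n k} (b : Fin n → Fin p) (f : Vec (Fin k) n) where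

    classes : Classes k
    classes = addAll b f (replicate k ⊥)

    -- A block belongs to class c exactly if one of its vertices has colour c. Two adjacent blocks
    -- in one class thus yield two vertices of equal colour, and these are adjacent because their
    -- blocks are.
    proper⇒independent : Proper (pullback b H) f → All (Independent H) classes
    proper⇒independent proper = All.lookup⁻ λ c i j i∈ j∈ → edge c i j (vertex i∈) (vertex j∈)
      where
      vertex : ∀ {c i} → i ∈ lookup classes c → ∃ λ v → b v ≡ i × lookup f v ≡ c
      vertex {c} {i} i∈ with ∈-addAll⁻ b f (replicate k ⊥) i∈
      ... | inj₁ i∈⊥ = contradiction (subst (i ∈_) (Vec.lookup-replicate c ⊥) i∈⊥) ∉⊥
      ... | inj₂ v   = v
      edge : ∀ c i j → (∃ λ v → b v ≡ i × lookup f v ≡ c) → (∃ λ v → b v ≡ j × lookup f v ≡ c) →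
             ¬ Graph.Adj H i j
      edge c _ _ (u , refl , fu≡c) (v , refl , fv≡c) adj = proper u v adj (trans fu≡c (sym fv≡c))

    independent⇒proper : All (Independent H) classes → Proper (pullback b H) f
    independent⇒proper ind u v adj fu≡fv = All.lookup⁺ ind (lookup f u) (b u) (b v)
      (∈-addAll⁺ b f _ (inj₂ (u , refl , refl)))
      (∈-addAll⁺ b f _ (inj₂ (v , refl , sym fu≡fv))) adj

  egf-#properColourings : ∀ k l → egf (λ l → natℚ (#properColourings (blowUp H l) k)) l ≡ (B H ^ k) l
  egf-#properColourings k l = begin
    natℚ (#properColourings (blowUp H l) k) ℚ.* invFactorials l
      ≡⟨ cong₂ (λ m α → natℚ m ℚ.* invFactorials α)
           (count-≐ (proper? (blowUp H l)) (λ f → independents? (addAll (block l) f (replicate k ⊥)))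
             (proper⇒independent (block l)) (independent⇒proper (block l)) (vectors (allFin k) (Vec.sum l)))
           (sym (tally-block l)) ⟩
    natℚ (count (λ f → independents? (addAll (block l) f (replicate k ⊥))) (vectors (allFin k) (Vec.sum l)))
      ℚ.* invFactorials (tally (block l))
      ≡⟨ colouring-count (block l) (replicate k ⊥) ⟩
    ∏extensions (replicate k ⊥) (tally (block l))
      ≡⟨ cong (∏extensions (replicate k ⊥)) (tally-block l) ⟩
    ∏extensions (replicate k ⊥) l
      ≡⟨ ∏extensions-⊥ k l ⟩
    (B H ^ k) l ∎
    where open ≡-Reasoning

  egf-χ-natℚ : ∀ k l → egf (λ l → evalℚ (χ (blowUp H l)) (natℚ k)) l ≡ (B H ^ˢ natℚ k) l
  egf-χ-natℚ k l = begin
    evalℚ (χ (blowUp H l)) (natℚ k) ℚ.* invFactorials l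
      ≡⟨ cong (ℚ._* invFactorials l) (χ-isChromaticPolynomial (blowUp H l) k) ⟩
    natℚ (#properColourings (blowUp H l) k) ℚ.* invFactorials l
      ≡⟨ egf-#properColourings k l ⟩
    (B H ^ k) l
      ≡⟨ ^ˢ-natℚ (B H) B-0 k l ⟨
    (B H ^ˢ natℚ k) l ∎
    where open ≡-Reasoning

-- From natural numbers to the indeterminate and to arbitrary algebras over ℚ

module Specialisation {c ℓ} (R : CommutativeRing c ℓ) (ι : ℚ → CommutativeRing.Carrier R)
                      (ι-hom : RingMorphisms.IsRingHomomorphism +-*-rawRing (CommutativeRing.rawRing R) ι)
                      {p} (H : Graph p) (q : CommutativeRing.Carrier R) where

  open CommutativeRing R using (rawRing; _≈_) renaming (refl to ≈-refl)
  open Evaluation R ι ι-hom q public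
  open Transport ℚ[q] R {constant} {ι} ev-isRingHomomorphism ev-constant
  open RingMorphisms.IsRingHomomorphism ev-isRingHomomorphism public using (1#-homo)
  private
    module P = PowerSeries ℚ[q] constant
    module R = PowerSeries rawRing ι

  ev-B : ∀ l → ev (P.B H l) ≈ R.B H l
  ev-B = ⇝-B H

  ev-egf-χ : ∀ l → ev (P.egf (λ l → χ (blowUp H l)) l) ≈ R.egf (λ l → ev (χ (blowUp H l))) l
  ev-egf-χ = ⇝-egf {a = λ l → χ (blowUp H l)} {b = λ l → ev (χ (blowUp H l))} (λ _ → ≈-refl)

  ev-B^q : ∀ l → ev ((P.B H P.^ˢ indeterminate) l) ≈ (R.B H R.^ˢ q) l
  ev-B^q = ⇝-^ˢ {f = P.B H} {g = R.B H} ev-B {a = indeterminate} {b = q} ev-indeterminate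

module Polynomials {p} (H : Graph p) where

  open PolynomialIdentity
  open PowerSeries ℚ[q] constant
  private module At k = Specialisation ℚ.+-*-commutativeRing id
                          (Identity.isRingHomomorphism +-*-rawRing refl) H (natℚ k)

  -- Even this constant term is compared through its values at natural numbers, so that the
  -- computation takes place in ℚ and not with coefficient lists.
  B-0 : ∀ n → coeff (B H (replicate p 0)) n ≡ coeff (constant 1ℚ) n
  B-0 = polynomial-identity (B H (replicate p 0)) (constant 1ℚ) λ k →
    trans (At.ev-B k (replicate p 0)) (trans (Colouring.B-0 H) (sym (At.ev-constant k 1ℚ)))

  egf-χ : egf (λ l → χ (blowUp H l)) ≋ B H ^ˢ indeterminate
  egf-χ l = polynomial-identity (egf (λ l → χ (blowUp H l)) l) ((B H ^ˢ indeterminate) l) λ k →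
    trans (At.ev-egf-χ k l) (trans (Colouring.egf-χ-natℚ H k l) (sym (At.ev-B^q k l)))

module Algebras {c ℓ} (R : CommutativeRing c ℓ) (ι : ℚ → CommutativeRing.Carrier R)
                (ι-hom : RingMorphisms.IsRingHomomorphism +-*-rawRing (CommutativeRing.rawRing R) ι)
                {p} (H : Graph p) where

  open CommutativeRing R using (Carrier; rawRing; _≈_; 0#; 1#)
    renaming (sym to ≈-sym; trans to ≈-trans)
  open PowerSeries rawRing ι
  private
    module P = PowerSeries ℚ[q] constant
    module At = Specialisation R ι ι-hom H

  B-0 : B H (replicate p 0) ≈ 1#
  -- The point `0#` is an arbitrary choice: the series `B H` does not involve the indeterminate.
  B-0 = ≈-trans (≈-sym (At.ev-B 0# (replicate p 0)))
    (≈-trans (At.ev-cong 0# (P.B H (replicate p 0)) (constant 1ℚ) (Polynomials.B-0 H)) (At.1#-homo 0#))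

  -- The identity over `ℚ[q]` is universal, and evaluation at `q` carries it to `R`. Evaluation is
  -- thus used twice: into ℚ at natural numbers to establish the identity, and into `R` to spread
  -- it.
  egf-χ : ∀ q → egf (λ l → evaluate rawRing ι (χ (blowUp H l)) q) ≋ B H ^ˢ q
  egf-χ q l = ≈-trans (≈-sym (At.ev-egf-χ q l))
    (≈-trans (At.ev-cong q (P.egf (λ l → χ (blowUp H l)) l) ((P.B H P.^ˢ indeterminate) l) (Polynomials.egf-χ H l))
             (At.ev-B^q q l))

proposition4 : ∀ (c ℓ : Level) (p : ℕ) (H : Graph p) →
    (let open RawRing ℚ[q] in
    let open PowerSeries ℚ[q] constant in
    (B H (replicate p 0) ≈ 1#)
    × (egf (λ l → χ (blowUp H l)) ≋ B H ^ˢ indeterminate))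
    ×
    ((R : CommutativeRing c ℓ) → let open CommutativeRing R in
    (ι : ℚ → Carrier) → RingMorphisms.IsRingHomomorphism +-*-rawRing rawRing ι →
    let open PowerSeries rawRing ι in
    (B H (replicate p 0) ≈ 1#)
    × (∀ (q : Carrier) → egf (λ l → evaluate rawRing ι (χ (blowUp H l)) q) ≋ B H ^ˢ q))
proposition4 c ℓ p H =
  (Polynomials.B-0 H , Polynomials.egf-χ H) ,
  λ R ι ι-hom → Algebras.B-0 R ι ι-hom H , Algebras.egf-χ R ι ι-hom H
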